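{- For all integers $n\ge4$ and $1\le d\le n-2$ and $m\ge d$, the Markov complexity of $m\times n$ integer matrices of rank $d$ may be arbitrarily large: for every positive integer $N$ there exists $A\in\mathbb{Z}^{m\times n}$ of rank $d$ with $m(A)\ge N$.
   Context: For $A\in\mathbb{Z}^{m\times n}$ and $r\ge2$, the $r$-th Lawrence lifting $A^{(r)}$ is the $(rm+n)\times rn$ matrix with $r$ copies of $A$ on the block diagonal and final block row $(I_n\ I_n\ \cdots\ I_n)$. Elements of $\operatorname{Ker}_{\mathbb{Z}}(A^{(r)})$ are identified with $r\times n$ integer matrices whose rows lie in $\operatorname{Ker}_{\mathbb{Z}}(A)$ and sum to zero; the type of such an element is its number of nonzero rows. For an integer matrix $M$ with $N'$ columns, a Markov basis is a finite set $\mathcal{M}\subseteq\operatorname{Ker}_{\mathbb{Z}}(M)$ such that whenever $\mathbf{w},\mathbf{u}\in\mathbb{N}^{N'}$ with $\mathbf{w}-\mathbf{u}\in\operatorname{Ker}_{\mathbb{Z}}(M)$ there exist $\mathbf{v}_1,\ldots,\mathbf{v}_p\in\mathcal{M}\cup(-\mathcal{M})$ with $\mathbf{w}-\sum_{i\le l}\mathbf{v}_i\in\mathbb{N}^{N'}$ for all $l$ and $\mathbf{w}-\mathbf{u}=\sum_{i=1}^p\mathbf{v}_i$; it is minimal if no proper subset is a Markov basis. The universal Markov basis of $M$ is the union of all minimal Markov bases (vectors differing by sign identified). The Markov complexity $m(A)$ is the largest type of any element of the universal Markov basis of $A^{(r)}$, as $r\ge2$ varies. -}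

module Defs where

open import Data.Nat as ℕ using (ℕ; zero; suc; _≤_)
open import Data.Integer as ℤ using (ℤ; +_; _+_; _*_; -_; _-_)
open import Data.Fin as Fin using (Fin; combine; remQuot; splitAt)
open import Data.Bool using (Bool; true; false; if_then_else_; not; _∨_)
open import Data.List using (List; []; _∷_; take; length)
open import Data.List.Relation.Unary.All using (All)
open import Data.List.Relation.Unary.Any using (Any)
open import Data.Product using (Σ; ∃; _×_; _,_; proj₁; proj₂)
open import Data.Sum using (_⊎_; inj₁; inj₂)
open import Relation.Nullary using (¬_; does)
open import Relation.Binary.PropositionalEquality using (_≡_)

Vecℤ : ℕ → Set
Vecℤ N = Fin N → ℤ

Matrix : ℕ → ℕ → Set
Matrix m n = Fin m → Fin n → ℤ

Σℤ : ∀ {k} → (Fin k → ℤ) → ℤ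
Σℤ {zero}  f = + 0
Σℤ {suc k} f = f Fin.zero + Σℤ (λ i → f (Fin.suc i))

count : ∀ {k} → (Fin k → Bool) → ℕ
count {zero}  b = 0
count {suc k} b = (if b Fin.zero then 1 else 0) ℕ.+ count (λ i → b (Fin.suc i))

anyFin : ∀ {k} → (Fin k → Bool) → Bool
anyFin {zero}  b = false
anyFin {suc k} b = b Fin.zero ∨ anyFin (λ i → b (Fin.suc i))

_==ℤ_ : ℤ → ℤ → Bool
infix 4 _==ℤ_ _==F_
x ==ℤ y = does (x ℤ.≟ y)

_==F_ : ∀ {k} → Fin k → Fin k → Bool
i ==F j = does (i Fin.≟ j)

-- Rank (over ℚ, equivalently maximal number of ℤ-linearly independent rows)

CombZero : ∀ {m n k} → Matrix m n → (Fin k → Fin m) → (Fin k → ℤ) → Set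
CombZero {n = n} A f c = ∀ (col : Fin n) → Σℤ (λ j → c j * A (f j) col) ≡ + 0

RowsIndependent : ∀ {m n k} → Matrix m n → (Fin k → Fin m) → Set
RowsIndependent {k = k} A f =
  (∀ (i j : Fin k) → f i ≡ f j → i ≡ j) ×
  (∀ (c : Fin k → ℤ) → CombZero A f c → ∀ j → c j ≡ + 0)

HasRank : ∀ {m n} → Matrix m n → ℕ → Set
HasRank {m} A d =
  (Σ (Fin d → Fin m) λ f → RowsIndependent A f) ×
  (∀ (g : Fin (suc d) → Fin m) → ¬ RowsIndependent A g)

InKer : ∀ {p N} → Matrix p N → Vecℤ N → Set
InKer {p} {N} M v = ∀ (i : Fin p) → Σℤ (λ j → M i j * v j) ≡ + 0

-- Markov bases (finite sets represented by lists, vectors compared pointwise)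

_≗ᵥ_ : ∀ {N} → Vecℤ N → Vecℤ N → Set
v ≗ᵥ w = ∀ i → v i ≡ w i

negᵥ : ∀ {N} → Vecℤ N → Vecℤ N
negᵥ v i = - v i

Mem : ∀ {N} → Vecℤ N → List (Vecℤ N) → Set
Mem v ℳ = Any (λ b → v ≗ᵥ b) ℳ

MemPM : ∀ {N} → Vecℤ N → List (Vecℤ N) → Set
MemPM v ℳ = Any (λ b → v ≗ᵥ b ⊎ v ≗ᵥ negᵥ b) ℳ

sumᵥ : ∀ {N} → List (Vecℤ N) → Vecℤ N
sumᵥ []       i = + 0
sumᵥ (v ∷ vs) i = v i + sumᵥ vs i

toℤᵥ : ∀ {N} → (Fin N → ℕ) → Vecℤ N
toℤᵥ w i = + (w i)

IsMarkovBasis : ∀ {p N} → Matrix p N → List (Vecℤ N) → Set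
IsMarkovBasis {p} {N} M ℳ =
  All (InKer M) ℳ ×
  (∀ (w u : Fin N → ℕ) → InKer M (λ i → toℤᵥ w i - toℤᵥ u i) →
     Σ (List (Vecℤ N)) λ vs →
       All (λ v → MemPM v ℳ) vs ×
       (∀ (l : ℕ) → l ≤ length vs → ∀ i → + 0 ℤ.≤ toℤᵥ w i - sumᵥ (take l vs) i) ×
       (∀ i → toℤᵥ w i - toℤᵥ u i ≡ sumᵥ vs i))

IsMinimalMarkovBasis : ∀ {p N} → Matrix p N → List (Vecℤ N) → Set
IsMinimalMarkovBasis {N = N} M ℳ =
  IsMarkovBasis M ℳ ×
  (∀ (ℳ' : List (Vecℤ N)) →
     (∀ v → Mem v ℳ' → Mem v ℳ) →
     (Σ (Vecℤ N) λ v → Mem v ℳ × ¬ Mem v ℳ') →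
     ¬ IsMarkovBasis M ℳ')

-- v belongs to the universal Markov basis (union of all minimal Markov bases,
-- vectors differing by sign identified)
InUniversalMarkovBasis : ∀ {p N} → Matrix p N → Vecℤ N → Set
InUniversalMarkovBasis {N = N} M v =
  Σ (List (Vecℤ N)) λ ℳ → IsMinimalMarkovBasis M ℳ × MemPM v ℳ

-- Lawrence lifting A^(r) : (r m + n) × (r n) matrix.
-- Column index combine k l (block k : Fin r, column l : Fin n);
-- row index: first r·m rows are combine k' a (block k', row a of A),
-- last n rows form (I_n I_n ⋯ I_n).

lawrence : ∀ {m n} → Matrix m n → (r : ℕ) → Matrix (r ℕ.* m ℕ.+ n) (r ℕ.* n)
lawrence {m} {n} A r i j with remQuot {r} n j
... | (k , l) with splitAt (r ℕ.* m) i
...   | inj₁ i' with remQuot {r} m i'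
...     | (k' , a) = if k' ==F k then A a l else + 0
lawrence {m} {n} A r i j | (k , l) | inj₂ c = if c ==F l then + 1 else + 0

typeOf : ∀ {n} (r : ℕ) → Vecℤ (r ℕ.* n) → ℕ
typeOf {n} r v = count {r} (λ k → anyFin {n} (λ l → not (v (combine k l) ==ℤ (+ 0))))

MarkovComplexityAtLeast : ∀ {m n} → Matrix m n → ℕ → Set
MarkovComplexityAtLeast {m} {n} A N =
  Σ ℕ λ r → 2 ≤ r × Σ (Vecℤ (r ℕ.* n)) λ v →
    InUniversalMarkovBasis (lawrence A r) v × N ≤ typeOf r v

module Submission where

-- Let t = N and δ = 4 t + 5. A row with entries 1 , 1 + δ , 1 + δ (t + 1) , 1 + δ (t + 2) has in its
-- kernel v₀ = (−t , t + 1 , −1 , 0), u = (1 , −1 , −1 , 1) and v₀ + t u. Since δ is large, on vectors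
-- with small entries it determines both Σ xᵢ and x₁ + (t + 1) x₂ + (t + 2) x₃, so that within the range
-- allowed by the column sums of the lifting the fibers of v₀, u and v₀ + t u have only two points each.
-- Hence the relation v₀ + u + ⋯ + u − (v₀ + t u) = 0, spread over t + 2 rows, is an element of the
-- kernel of the (t + 2)-nd Lawrence lifting whose fiber has only two points, because no proper nonempty
-- subset of its rows sums to zero. Such an element lies, up to sign, in every Markov basis.
-- It remains to exhibit one minimal Markov basis. The solutions over ℕ of M w = M u form a finitely
-- generated monoid, whose generators give a finite Markov basis; the fibers of a Lawrence lifting are
-- finite, so redundancy of an element is decidable and redundant elements can be discarded one by one.

open import Defs
open import Data.Nat using (ℕ; _≤_; _+_)
open import Data.Product using (Σ; _×_)

import Algebra.Properties.Semiring.Sum as Sum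
open import Data.Bool using (Bool; true; false; not; if_then_else_)
import Data.Bool.Properties as Bool
open import Data.Empty using (⊥-elim)
open import Data.Fin as Fin using (Fin; combine; remQuot; splitAt; _↑ˡ_; _↑ʳ_; toℕ; fromℕ<; inject≤)
open import Data.Fin.Patterns using (0F; 1F; 2F; 3F)
open import Data.Fin.Properties as Fin using (splitAt-↑ˡ; splitAt-↑ʳ)
open import Data.Integer as ℤ using (ℤ; +_; -[1+_])
import Data.Integer.Properties as ℤ
open import Data.Integer.Tactic.RingSolver using (solve-∀)
open import Data.List as List using (List; []; _∷_; length; lookup)
open import Data.List.Membership.Propositional using (_∈_; find)
open import Data.List.Membership.Propositional.Properties using (∈-lookup)
import Data.List.Properties as List
open import Data.List.Relation.Unary.All as All using (All; []; _∷_)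
import Data.List.Relation.Unary.All.Properties as All
open import Data.List.Relation.Unary.Any as Any using (Any; here; there)
import Data.List.Relation.Unary.Any.Properties as Any
open import Data.Nat as ℕ using (zero; suc; _<_; _*_; _∸_; z≤n; s≤s)
open import Data.Nat.DivMod using (_%_; m<n⇒m%n≡m; [m+kn]%n≡m%n)
import Data.Nat.Properties as ℕ
import Data.Nat.Tactic.RingSolver as ℕ-Solver
open import Data.Product as Product using (∃; _,_; proj₁; proj₂)
open import Data.Sum as ⊎ using (_⊎_; inj₁; inj₂; [_,_]′)
import Data.Vec.Functional as Vector
open import Function using (_∘_)
open import Relation.Binary.PropositionalEquality
open import Relation.Nullary
open import Relation.Nullary.Decidable using (map′; dec-true; dec-false; decidable-stable)

open Sum ℕ.+-*-semiring using (sum; sum-cong-≗; ∑-distrib-+; *-distribʳ-sum)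
private module Sumℤ = Sum ℤ.+-*-semiring

private
  variable
    k m n r t N : ℕ

-- Finite sums

Σℤ-cong : {f g : Fin k → ℤ} → f ≗ g → Σℤ f ≡ Σℤ g
Σℤ-cong {zero}  f≗g = refl
Σℤ-cong {suc k} f≗g = cong₂ ℤ._+_ (f≗g Fin.zero) (Σℤ-cong (f≗g ∘ Fin.suc))

Σℤ≡sum : (f : Fin k → ℤ) → Σℤ f ≡ Sumℤ.sum f
Σℤ≡sum {zero}  f = refl
Σℤ≡sum {suc k} f = cong (ℤ._+_ (f Fin.zero)) (Σℤ≡sum (f ∘ Fin.suc))

Σℤ-zero : (f : Fin k → ℤ) → (∀ i → f i ≡ + 0) → Σℤ f ≡ + 0
Σℤ-zero {zero}  f f≗0 = refl
Σℤ-zero {suc k} f f≗0 = cong₂ ℤ._+_ (f≗0 Fin.zero) (Σℤ-zero (f ∘ Fin.suc) (f≗0 ∘ Fin.suc))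

Σℤ-+ : (f g : Fin k → ℤ) → Σℤ (λ i → f i ℤ.+ g i) ≡ Σℤ f ℤ.+ Σℤ g
Σℤ-+ f g = trans (Σℤ≡sum (λ i → f i ℤ.+ g i)) (trans (Sumℤ.∑-distrib-+ f g) (sym (cong₂ ℤ._+_ (Σℤ≡sum f) (Σℤ≡sum g))))

Σℤ-*ˡ : (c : ℤ) (f : Fin k → ℤ) → Σℤ (λ i → c ℤ.* f i) ≡ c ℤ.* Σℤ f
Σℤ-*ˡ c f = trans (Σℤ≡sum (λ i → c ℤ.* f i)) (trans (sym (Sumℤ.*-distribˡ-sum c f)) (cong (c ℤ.*_) (sym (Σℤ≡sum f))))

Σℤ-*ʳ : (c : ℤ) (f : Fin k → ℤ) → Σℤ (λ i → f i ℤ.* c) ≡ Σℤ f ℤ.* c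
Σℤ-*ʳ c f = trans (Σℤ≡sum (λ i → f i ℤ.* c)) (trans (sym (Sumℤ.*-distribʳ-sum c f)) (cong (ℤ._* c) (sym (Σℤ≡sum f))))

Σℤ-neg : (f : Fin k → ℤ) → Σℤ (λ i → ℤ.- f i) ≡ ℤ.- Σℤ f
Σℤ-neg {zero}  f = refl
Σℤ-neg {suc k} f = trans (cong (ℤ._+_ (ℤ.- f Fin.zero)) (Σℤ-neg (f ∘ Fin.suc)))
                         (sym (ℤ.neg-distrib-+ (f Fin.zero) _))

Σℤ-swap : (f : Fin k → Fin n → ℤ) → Σℤ (λ i → Σℤ (f i)) ≡ Σℤ (λ j → Σℤ (λ i → f i j))
Σℤ-swap f = begin
  Σℤ (λ i → Σℤ (f i))                          ≡⟨ Σℤ-cong (λ i → Σℤ≡sum (f i)) ⟩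
  Σℤ (λ i → Sumℤ.sum (f i))                    ≡⟨ Σℤ≡sum (λ i → Sumℤ.sum (f i)) ⟩
  Sumℤ.sum (λ i → Sumℤ.sum (f i))              ≡⟨ Sumℤ.∑-comm f ⟩
  Sumℤ.sum (λ j → Sumℤ.sum (λ i → f i j))      ≡⟨ Σℤ≡sum (λ j → Sumℤ.sum (λ i → f i j)) ⟨
  Σℤ (λ j → Sumℤ.sum (λ i → f i j))            ≡⟨ Σℤ-cong (λ j → sym (Σℤ≡sum (λ i → f i j))) ⟩
  Σℤ (λ j → Σℤ (λ i → f i j))                  ∎
  where open ≡-Reasoning

Σℤ-single : (j : Fin k) (f : Fin k → ℤ) → (∀ i → i ≢ j → f i ≡ + 0) → Σℤ f ≡ f j
Σℤ-single Fin.zero    f f≗0 = trans (cong (ℤ._+_ (f Fin.zero)) (Σℤ-zero (f ∘ Fin.suc) (λ i → f≗0 (Fin.suc i) (λ ()))))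
                                    (ℤ.+-identityʳ _)
Σℤ-single (Fin.suc j) f f≗0 = trans (cong₂ ℤ._+_ (f≗0 Fin.zero (λ ()))
                                      (Σℤ-single j (f ∘ Fin.suc) (λ i i≢j → f≗0 (Fin.suc i) (i≢j ∘ Fin.suc-injective))))
                                    (ℤ.+-identityˡ _)

Σℤ-↑ : ∀ m {n} (f : Fin (m ℕ.+ n) → ℤ) →
       Σℤ f ≡ Σℤ (λ i → f (i ↑ˡ n)) ℤ.+ Σℤ (λ j → f (m ↑ʳ j))
Σℤ-↑ zero    f = sym (ℤ.+-identityˡ _)
Σℤ-↑ (suc m) f = trans (cong (ℤ._+_ (f Fin.zero)) (Σℤ-↑ m (f ∘ Fin.suc))) (sym (ℤ.+-assoc (f Fin.zero) _ _))

Σℤ-combine : ∀ r {n} (f : Fin (r ℕ.* n) → ℤ) → Σℤ f ≡ Σℤ {r} (λ k → Σℤ {n} (λ l → f (combine k l)))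
Σℤ-combine zero        f = refl
Σℤ-combine (suc r) {n} f = trans (Σℤ-↑ n f) (cong (ℤ._+_ (Σℤ (λ i → f (i ↑ˡ (r ℕ.* n))))) (Σℤ-combine r (λ j → f (n ↑ʳ j))))

Σℤ-+ₙ : (f : Fin k → ℕ) → Σℤ (λ i → + f i) ≡ + sum f
Σℤ-+ₙ {zero}  f = refl
Σℤ-+ₙ {suc k} f = cong (ℤ._+_ (+ f Fin.zero)) (Σℤ-+ₙ (f ∘ Fin.suc))

Σℤ-diff : (f g : Fin k → ℕ) → Σℤ (λ i → + f i ℤ.- + g i) ≡ + sum f ℤ.- + sum g
Σℤ-diff f g = trans (Σℤ-+ (λ i → + f i) (λ i → ℤ.- + g i))
                    (cong₂ ℤ._+_ (Σℤ-+ₙ f) (trans (Σℤ-neg (λ i → + g i)) (cong ℤ.-_ (Σℤ-+ₙ g))))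

sum-mono : {f g : Fin k → ℕ} → (∀ i → f i ≤ g i) → sum f ≤ sum g
sum-mono {zero}  f≤g = z≤n
sum-mono {suc k} f≤g = ℕ.+-mono-≤ (f≤g Fin.zero) (sum-mono (f≤g ∘ Fin.suc))

term≤sum : (f : Fin k → ℕ) (i : Fin k) → f i ≤ sum f
term≤sum f Fin.zero    = ℕ.m≤m+n _ _
term≤sum f (Fin.suc i) = ℕ.≤-trans (term≤sum (f ∘ Fin.suc) i) (ℕ.m≤n+m _ _)

pos neg : ℤ → ℕ
pos (+ n)    = n
pos -[1+ n ] = 0
neg z = pos (ℤ.- z)

pos-neg : ∀ z → + pos z ℤ.- + neg z ≡ z
pos-neg (+ zero)   = refl
pos-neg (+ suc n)  = ℤ.+-identityʳ _
pos-neg -[1+ n ]   = refl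

pos≤∣∣ : ∀ z → pos z ≤ ℤ.∣ z ∣
pos≤∣∣ (+ n)    = ℕ.≤-refl
pos≤∣∣ -[1+ n ] = z≤n

-- Generators of the monoid of nonnegative solutions of a linear system

lin : (Fin k → ℤ) → (Fin k → ℕ) → ℤ
lin c y = Σℤ (λ i → c i ℤ.* + y i)

lin-cong : (c : Fin k → ℤ) {x y : Fin k → ℕ} → x ≗ y → lin c x ≡ lin c y
lin-cong c x≗y = Σℤ-cong (λ i → cong (λ a → c i ℤ.* + a) (x≗y i))

lin-+ : (c : Fin k → ℤ) (x y : Fin k → ℕ) → lin c (λ i → x i + y i) ≡ lin c x ℤ.+ lin c y
lin-+ c x y = trans (Σℤ-cong (λ i → ℤ.*-distribˡ-+ (c i) (+ x i) (+ y i))) (Σℤ-+ (λ i → c i ℤ.* + x i) (λ i → c i ℤ.* + y i))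

lin-neg : (c : Fin k → ℤ) (y : Fin k → ℕ) → lin (λ i → ℤ.- c i) y ≡ ℤ.- lin c y
lin-neg c y = trans (Σℤ-cong (λ i → sym (ℤ.neg-distribˡ-* (c i) (+ y i)))) (Σℤ-neg (λ i → c i ℤ.* + y i))

lin-pos-neg : (c : Fin k → ℤ) (y : Fin k → ℕ) →
              lin c y ≡ + sum (λ i → pos (c i) * y i) ℤ.- + sum (λ i → neg (c i) * y i)
lin-pos-neg c y = trans (Σℤ-cong eq) (Σℤ-diff (λ i → pos (c i) * y i) (λ i → neg (c i) * y i))
  where
  open ≡-Reasoning
  distrib : ∀ (p q y : ℤ) → (p ℤ.- q) ℤ.* y ≡ p ℤ.* y ℤ.- q ℤ.* y
  distrib = solve-∀
  eq : ∀ i → c i ℤ.* + y i ≡ + (pos (c i) * y i) ℤ.- + (neg (c i) * y i)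
  eq i = begin
    c i ℤ.* + y i                                          ≡⟨ cong (ℤ._* + y i) (pos-neg (c i)) ⟨
    (+ pos (c i) ℤ.- + neg (c i)) ℤ.* + y i                ≡⟨ distrib (+ pos (c i)) (+ neg (c i)) (+ y i) ⟩
    + pos (c i) ℤ.* + y i ℤ.- + neg (c i) ℤ.* + y i
      ≡⟨ cong₂ ℤ._-_ (ℤ.pos-* (pos (c i)) (y i)) (ℤ.pos-* (neg (c i)) (y i)) ⟨
    + (pos (c i) * y i) ℤ.- + (neg (c i) * y i)            ∎

scaledUnit : Fin k → ℕ → Fin k → ℕ
scaledUnit i a j = if does (j Fin.≟ i) then a else 0

scaledUnit-≡ : (i : Fin k) (a : ℕ) → scaledUnit i a i ≡ a
scaledUnit-≡ i a with i Fin.≟ i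
... | yes _  = refl
... | no i≢i = ⊥-elim (i≢i refl)

scaledUnit-≢ : (i : Fin k) (a : ℕ) {j : Fin k} → j ≢ i → scaledUnit i a j ≡ 0
scaledUnit-≢ i a {j} j≢i with j Fin.≟ i
... | yes j≡i = ⊥-elim (j≢i j≡i)
... | no _    = refl

scaledUnit-≤ : (i : Fin k) (a : ℕ) (j : Fin k) → scaledUnit i a j ≤ a
scaledUnit-≤ i a j with j Fin.≟ i
... | yes _ = ℕ.≤-refl
... | no _  = z≤n

lin-scaledUnit : (c : Fin k → ℤ) (i : Fin k) (a : ℕ) → lin c (scaledUnit i a) ≡ c i ℤ.* + a
lin-scaledUnit c i a = trans
  (Σℤ-single i _ (λ j j≢i → trans (cong (λ b → c j ℤ.* + b) (scaledUnit-≢ i a j≢i)) (ℤ.*-zeroʳ (c j))))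
  (cong (λ b → c i ℤ.* + b) (scaledUnit-≡ i a))

-- The `suc` makes this exceed `Σ ∣ c i ∣` strictly and keeps it at least 1, so that unit vectors
-- obey it even if all coefficients vanish.
bound : (Fin k → ℤ) → ℕ
bound c = suc (sum (λ i → ℤ.∣ c i ∣))

∣c∣<bound : (c : Fin k → ℤ) (i : Fin k) → ℤ.∣ c i ∣ < bound c
∣c∣<bound c i = s≤s (term≤sum (λ i → ℤ.∣ c i ∣) i)

-- What a large solution gives up in the descent below: a nonzero solution under `y` whose entries
-- are bounded independently of `y`.
record SmallPart (c : Fin k → ℤ) (y : Fin k → ℕ) : Set where
  field
    part     : Fin k → ℕ
    solution : lin c part ≡ + 0
    part≤y   : ∀ i → part i ≤ y i
    part≤b   : ∀ i → part i ≤ bound c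
    index    : Fin k
    nonzero  : 0 < part index

open SmallPart

-- If no i has c i > 0 and y i ≥ ∣ c j ∣, then the positive terms of the equation add up to
-- at most ∣ c j ∣ Σ ∣ c i ∣, which the single negative term ∣ c j ∣ y j exceeds.
smallPart-neg : (c : Fin k → ℤ) (y : Fin k → ℕ) → lin c y ≡ + 0 →
                (j : Fin k) (a : ℕ) → c j ≡ -[1+ a ] → bound c < y j → SmallPart c y
smallPart-neg c y sol j a cj≡ b<yj
  with Fin.any? (λ i → suc a ℕ.≤? y i ×-dec 0 ℕ.<? pos (c i))
... | yes (i , a<yi , 0<ci) = record
  { part     = z
  ; solution = zsol
  ; part≤y   = z≤y
  ; part≤b   = λ l → z≤ l (bound c) (ℕ.<⇒≤ q≤b) (ℕ.<⇒≤ p≤b)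
  ; index    = i
  ; nonzero  = ℕ.<-≤-trans (subst (0 <_) (sym (scaledUnit-≡ i q)) (s≤s z≤n)) (ℕ.m≤m+n _ _)
  }
  where
  open ≡-Reasoning
  q = suc a
  p = pos (c i)
  -- `∣ c j ∣` units at `i` against `c i` units at `j`: the two terms of the equation cancel.
  z : Fin _ → ℕ
  z l = scaledUnit i q l + scaledUnit j p l
  i≢j : i ≢ j
  i≢j refl = ℕ.<⇒≢ 0<ci (sym (cong pos cj≡))
  q≤b : q < bound c
  q≤b = subst (λ x → ℤ.∣ x ∣ < bound c) cj≡ (∣c∣<bound c j)
  p≤b : p < bound c
  p≤b = ℕ.≤-<-trans (pos≤∣∣ (c i)) (∣c∣<bound c i)
  z≤ : ∀ l B → q ≤ B → p ≤ B → z l ≤ B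
  z≤ l B q≤B p≤B with l Fin.≟ i
  ... | yes refl = subst (_≤ B) (sym (trans (cong (_+_ q) (scaledUnit-≢ j p i≢j)) (ℕ.+-identityʳ _))) q≤B
  ... | no _     = ℕ.≤-trans (scaledUnit-≤ j p l) p≤B
  z≤y : ∀ l → z l ≤ y l
  z≤y l with l Fin.≟ i
  ... | yes refl = subst (_≤ y i) (sym (trans (cong (_+_ q) (scaledUnit-≢ j p i≢j)) (ℕ.+-identityʳ _))) a<yi
  ... | no _ with l Fin.≟ j
  ...   | yes refl = ℕ.<⇒≤ (ℕ.<-trans p≤b b<yj)
  ...   | no _     = z≤n
  ci≡ : ∀ x → 0 < pos x → x ≡ + pos x
  ci≡ (+ x) _ = refl
  cancel : ∀ (p q : ℤ) → p ℤ.* q ℤ.+ (ℤ.- q) ℤ.* p ≡ + 0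
  cancel = solve-∀
  zsol : lin c z ≡ + 0
  zsol = begin
    lin c z                                          ≡⟨ lin-+ c (scaledUnit i q) (scaledUnit j p) ⟩
    lin c (scaledUnit i q) ℤ.+ lin c (scaledUnit j p) ≡⟨ cong₂ ℤ._+_ (lin-scaledUnit c i q) (lin-scaledUnit c j p) ⟩
    c i ℤ.* + q ℤ.+ c j ℤ.* + p                      ≡⟨ cong₂ (λ u v → u ℤ.* + q ℤ.+ v ℤ.* + p) (ci≡ (c i) 0<ci) cj≡ ⟩
    + p ℤ.* + q ℤ.+ -[1+ a ] ℤ.* + p                 ≡⟨ cancel (+ p) (+ q) ⟩
    + 0                                              ∎
... | no none = ⊥-elim (ℕ.<-irrefl refl (ℕ.<-≤-trans b<yj (ℕ.m≤n⇒m≤1+n yj≤S)))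
  where
  open ℕ.≤-Reasoning
  q = suc a
  S = sum (λ i → ℤ.∣ c i ∣)
  term : ∀ i → pos (c i) * y i ≤ ℤ.∣ c i ∣ * q
  term i with suc a ℕ.≤? y i | pos (c i) in eq
  ... | no yi<q  | p     = ℕ.*-mono-≤ (subst (_≤ ℤ.∣ c i ∣) eq (pos≤∣∣ (c i))) (ℕ.<⇒≤ (ℕ.≰⇒> yi<q))
  ... | yes _    | zero  = z≤n
  ... | yes a<yi | suc p = ⊥-elim (none (i , a<yi , subst (0 <_) (sym eq) (s≤s z≤n)))
  balance : sum (λ i → neg (c i) * y i) ≡ sum (λ i → pos (c i) * y i)
  balance = sym (ℤ.+-injective (ℤ.i-j≡0⇒i≡j _ _ (trans (sym (lin-pos-neg c y)) sol)))
  yj≤S : y j ≤ S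
  yj≤S = ℕ.*-cancelʳ-≤ (y j) S q (begin
    y j * q                          ≡⟨ ℕ.*-comm (y j) q ⟩
    q * y j                          ≡⟨ cong (λ x → neg x * y j) cj≡ ⟨
    neg (c j) * y j                  ≤⟨ term≤sum (λ i → neg (c i) * y i) j ⟩
    sum (λ i → neg (c i) * y i)      ≡⟨ balance ⟩
    sum (λ i → pos (c i) * y i)      ≤⟨ sum-mono term ⟩
    sum (λ i → ℤ.∣ c i ∣ * q)        ≡⟨ *-distribʳ-sum q (λ i → ℤ.∣ c i ∣) ⟨
    S * q                            ∎)

-- The sign of `c j` decides. If it is zero, the unit vector at `j` is a solution. If it is
-- positive, negating the equation reduces to the negative case and leaves `bound` unchanged.
smallPart : (c : Fin k → ℤ) (y : Fin k → ℕ) → lin c y ≡ + 0 →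
            (j : Fin k) → bound c < y j → SmallPart c y
smallPart c y sol j b<yj with c j in eq
... | -[1+ a ] = smallPart-neg c y sol j a eq b<yj
... | + zero   = record
  { part     = scaledUnit j 1
  ; solution = trans (lin-scaledUnit c j 1) (cong (ℤ._* + 1) eq)
  ; part≤y   = e≤y
  ; part≤b   = λ l → ℕ.≤-trans (scaledUnit-≤ j 1 l) (s≤s z≤n)
  ; index    = j
  ; nonzero  = subst (0 <_) (sym (scaledUnit-≡ j 1)) (s≤s z≤n)
  }
  where
  e≤y : ∀ l → scaledUnit j 1 l ≤ y l
  e≤y l with l Fin.≟ j
  ... | yes refl = ℕ.≤-trans (s≤s z≤n) b<yj
  ... | no _     = z≤n
... | + suc a = record
  { part     = part P
  ; solution = ℤ.neg-injective (trans (sym (lin-neg c (part P))) (solution P))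
  ; part≤y   = part≤y P
  ; part≤b   = λ l → subst (part P l ≤_) bound≡ (part≤b P l)
  ; index    = index P
  ; nonzero  = nonzero P
  }
  where
  bound≡ : bound (λ i → ℤ.- c i) ≡ bound c
  bound≡ = cong suc (sum-cong-≗ (λ i → ℤ.∣-i∣≡∣i∣ (c i)))
  P : SmallPart (λ i → ℤ.- c i) y
  P = smallPart-neg (λ i → ℤ.- c i) y (trans (lin-neg c y) (cong ℤ.-_ sol)) j a (cong ℤ.-_ eq)
        (subst (_< y j) (sym bound≡) b<yj)

box : ∀ k → ℕ → List (Fin k → ℕ)
box zero    B = (λ ()) ∷ []
box (suc k) B = List.cartesianProductWith Vector._∷_ (List.upTo (suc B)) (box k B)

∈-box : ∀ {B} (y : Fin k → ℕ) → (∀ i → y i ≤ B) → Any (y ≗_) (box k B)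
∈-box {zero}  y y≤B = here (λ ())
∈-box {suc k} y y≤B =
  Any.cartesianProductWith⁺ Vector._∷_ {P = y Fin.zero ≡_}
    (λ { p q Fin.zero → p ; p q (Fin.suc i) → q i })
    (Any.applyUpTo⁺ (λ a → a) refl (s≤s (y≤B Fin.zero)))
    (∈-box (y ∘ Fin.suc) (y≤B ∘ Fin.suc))

-- The submonoid generated by `G`. The constructors take pointwise equations, which closes it under
-- `_≗_` without function extensionality.
data Gen (G : List (Fin k → ℕ)) : (Fin k → ℕ) → Set where
  zero : ∀ {x} → (∀ i → x i ≡ 0) → Gen G x
  plus : ∀ {x x′} → Any (λ g → ∀ i → x i ≡ g i + x′ i) G → Gen G x′ → Gen G x

Generates : List (Fin k → ℕ) → ((Fin k → ℕ) → Set) → Set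
Generates G S = All S G × (∀ y → S y → Gen G y)

-- The generators are the solutions in the box of side `bound c`. A solution outside the box splits
-- off a nonzero small part, itself a generator, and the sum of the entries of the rest is smaller.
solutions-generated : (c : Fin k → ℤ) → ∃ λ G → Generates G (λ y → lin c y ≡ + 0)
solutions-generated {k} c = G , All.all-filter sol? (box k (bound c)) , λ y → generate (suc (sum y)) y ℕ.≤-refl
  where
  sol? : ∀ y → Dec (lin c y ≡ + 0)
  sol? y = lin c y ℤ.≟ + 0
  G = List.filter sol? (box k (bound c))

  ∈G : ∀ y → (∀ i → y i ≤ bound c) → lin c y ≡ + 0 → Any (y ≗_) G
  ∈G y y≤b sol with Any.filter⁺ sol? (∈-box y y≤b)
  ... | inj₁ y∈G  = y∈G
  ... | inj₂ ¬sol = ⊥-elim (¬sol (trans (sym (lin-cong c (Any.lookup-result (∈-box y y≤b)))) sol))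

  generate : ∀ fuel y → sum y < fuel → lin c y ≡ + 0 → Gen G y
  generate (suc fuel) y y<fuel sol with Fin.any? (λ j → bound c ℕ.<? y j)
  ... | no ¬large = plus (Any.map (λ y≗g i → trans (y≗g i) (sym (ℕ.+-identityʳ _)))
                                  (∈G y (λ i → ℕ.≮⇒≥ (λ b<yi → ¬large (i , b<yi))) sol))
                         (zero (λ _ → refl))
  ... | yes (j , b<yj) = plus (Any.map (λ z≗g i → trans (split i) (cong (_+ rest i) (z≗g i)))
                                       (∈G (part P) (part≤b P) (solution P)))
                              (generate fuel rest (ℕ.<-≤-trans smaller (ℕ.s≤s⁻¹ y<fuel)) restSol)
    where
    P = smallPart c y sol j b<yj
    rest : Fin k → ℕ
    rest i = y i ∸ part P i
    split : ∀ i → y i ≡ part P i + rest i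
    split i = sym (ℕ.m+[n∸m]≡n (part≤y P i))
    smaller : sum rest < sum y
    smaller = subst (sum rest <_) (sym (trans (sum-cong-≗ split) (∑-distrib-+ (part P) rest)))
      (ℕ.+-monoˡ-≤ (sum rest) (ℕ.<-≤-trans (nonzero P) (term≤sum (part P) (index P))))
    restSol : lin c rest ≡ + 0
    restSol = trans (sym (ℤ.+-identityˡ _)) (trans (cong (ℤ._+ lin c rest) (sym (solution P)))
                (trans (sym (lin-+ c (part P) rest)) (trans (sym (lin-cong c split)) sol)))

comb : (G : List (Fin k → ℕ)) → (Fin (length G) → ℕ) → Fin k → ℕ
comb G y i = sum (λ j → y j * lookup G j i)

comb-+ : (G : List (Fin k → ℕ)) (x y : Fin (length G) → ℕ) →
         ∀ i → comb G (λ j → x j + y j) i ≡ comb G x i + comb G y i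
comb-+ G x y i = trans (sum-cong-≗ (λ j → ℕ.*-distribʳ-+ (lookup G j i) (x j) (y j)))
                       (∑-distrib-+ (λ j → x j * lookup G j i) (λ j → y j * lookup G j i))

comb-zero : (G : List (Fin k → ℕ)) {y : Fin (length G) → ℕ} → (∀ j → y j ≡ 0) → ∀ i → comb G y i ≡ 0
comb-zero []      y≗0 i = refl
comb-zero (g ∷ G) y≗0 i = cong₂ _+_ (cong (_* g i) (y≗0 Fin.zero)) (comb-zero G (y≗0 ∘ Fin.suc) i)

-- The coefficient at the position to which the `Any` witness points is raised by one.
comb-increment : {P : (Fin k → ℕ) → Set} {G : List (Fin k → ℕ)} → Any P G → (y : Fin (length G) → ℕ) →
                 Σ (Fin (length G) → ℕ) λ y′ → ∃ λ g → P g × (∀ i → comb G y′ i ≡ g i + comb G y i)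
comb-increment {G = g ∷ G} (here Pg) y =
  (λ { Fin.zero → suc (y Fin.zero) ; (Fin.suc j) → y (Fin.suc j) }) , g , Pg ,
  λ i → ℕ.+-assoc (g i) (y Fin.zero * g i) _
comb-increment {G = h ∷ G} (there P) y with comb-increment P (y ∘ Fin.suc)
... | y′ , g , Pg , eq =
  (λ { Fin.zero → y Fin.zero ; (Fin.suc j) → y′ j }) , g , Pg ,
  λ i → trans (cong (_+_ (y Fin.zero * h i)) (eq i)) (+-rotate (y Fin.zero * h i) (g i) _)
  where
  +-rotate : ∀ a b c → a + (b + c) ≡ b + (a + c)
  +-rotate = ℕ-Solver.solve-∀

Gen⇒comb : {G : List (Fin k → ℕ)} {x : Fin k → ℕ} → Gen G x → Σ (Fin (length G) → ℕ) λ y → x ≗ comb G y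
Gen⇒comb {G = G} (zero x≗0) = (λ _ → 0) , λ i → trans (x≗0 i) (sym (comb-zero G (λ _ → refl) i))
Gen⇒comb (plus x∈ gen) with Gen⇒comb gen
... | y , x′≗ with comb-increment x∈ y
...   | y′ , g , x≗ , eq = y′ , λ i → trans (x≗ i) (trans (cong (_+_ (g i)) (x′≗ i)) (sym (eq i)))

lin-comb : (c : Fin k → ℤ) (G : List (Fin k → ℕ)) (y : Fin (length G) → ℕ) →
           lin c (comb G y) ≡ lin (λ j → lin c (lookup G j)) y
lin-comb c G y = begin
  Σℤ (λ i → c i ℤ.* + sum (λ j → y j * lookup G j i))
    ≡⟨ Σℤ-cong (λ i → trans (cong (c i ℤ.*_) (sym (Σℤ-+ₙ (λ j → y j * lookup G j i))))
                            (sym (Σℤ-*ˡ (c i) (λ j → + (y j * lookup G j i))))) ⟩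
  Σℤ (λ i → Σℤ (λ j → c i ℤ.* + (y j * lookup G j i)))
    ≡⟨ Σℤ-swap (λ i j → c i ℤ.* + (y j * lookup G j i)) ⟩
  Σℤ (λ j → Σℤ (λ i → c i ℤ.* + (y j * lookup G j i)))
    ≡⟨ Σℤ-cong (λ j → trans (Σℤ-cong (λ i → trans (cong (c i ℤ.*_) (ℤ.pos-* (y j) (lookup G j i)))
                                                  (rearrange (c i) (+ y j) (+ lookup G j i))))
                            (Σℤ-*ʳ (+ y j) (λ i → c i ℤ.* + lookup G j i))) ⟩
  Σℤ (λ j → lin c (lookup G j) ℤ.* + y j) ∎
  where
  open ≡-Reasoning
  rearrange : ∀ (a b c : ℤ) → a ℤ.* (b ℤ.* c) ≡ a ℤ.* c ℤ.* b
  rearrange = solve-∀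

lin-zero : {c : Fin k → ℤ} → (∀ i → c i ≡ + 0) → (y : Fin k → ℕ) → lin c y ≡ + 0
lin-zero c≗0 y = Σℤ-zero _ (λ i → cong (ℤ._* + y i) (c≗0 i))

Gen-comb : (G : List (Fin k → ℕ)) {H : List (Fin (length G) → ℕ)} {y : Fin (length G) → ℕ} {x : Fin k → ℕ} →
           x ≗ comb G y → Gen H y → Gen (List.map (comb G) H) x
Gen-comb G x≗ (zero y≗0) = zero (λ i → trans (x≗ i) (comb-zero G y≗0 i))
Gen-comb G x≗ (plus {x′ = y′} y∈ gen) =
  plus (Any.map⁺ (Any.map (λ {h} y≗ i → trans (x≗ i) (trans (sum-cong-≗ (λ j → cong (_* lookup G j i) (y≗ j)))
                                                            (comb-+ G h y′ i))) y∈))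
       (Gen-comb G (λ _ → refl) gen)

-- The solutions of the remaining equations are the combinations of finitely many generators,
-- and the first equation is a single linear equation in the coefficients.
system-generated : ∀ p (M : Fin p → Fin k → ℤ) → ∃ λ G → Generates G (λ y → ∀ i → lin (M i) y ≡ + 0)
-- Without equations every vector is a solution, and the equation with zero coefficients supplies
-- generators for all of them.
system-generated zero M with solutions-generated (λ _ → + 0)
... | G , _ , gen = G , All.tabulate (λ _ ()) , λ y _ → gen y (lin-zero (λ _ → refl) y)
system-generated (suc p) M with system-generated p (M ∘ Fin.suc)
... | G , G-sol , G-gen with solutions-generated (λ j → lin (M Fin.zero) (lookup G j))
...   | H , H-sol , H-gen = List.map (comb G) H , All.map⁺ (All.map sol H-sol) , gen
  where
  sol : ∀ {h} → lin (λ j → lin (M Fin.zero) (lookup G j)) h ≡ + 0 → ∀ i → lin (M i) (comb G h) ≡ + 0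
  sol {h} eq Fin.zero    = trans (lin-comb (M Fin.zero) G h) eq
  sol {h} eq (Fin.suc i) = trans (lin-comb (M (Fin.suc i)) G h)
                                 (lin-zero (λ j → All.lookup G-sol (∈-lookup j) i) h)
  gen : ∀ y → (∀ i → lin (M i) y ≡ + 0) → Gen (List.map (comb G) H) y
  gen y eq with Gen⇒comb (G-gen y (eq ∘ Fin.suc))
  ... | z , y≗ = Gen-comb G y≗ (H-gen z (trans (sym (lin-comb (M Fin.zero) G z))
                                               (trans (sym (lin-cong (M Fin.zero) y≗)) (eq Fin.zero))))

-- Connectivity of fibers

MemPM-resp : {v w : Vecℤ N} {ℳ : List (Vecℤ N)} → v ≗ w → MemPM v ℳ → MemPM w ℳ
MemPM-resp v≗w = Any.map λ where
  (inj₁ v≗b)  → inj₁ (λ i → trans (sym (v≗w i)) (v≗b i))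
  (inj₂ v≗-b) → inj₂ (λ i → trans (sym (v≗w i)) (v≗-b i))

MemPM-neg : {v : Vecℤ N} {ℳ : List (Vecℤ N)} → MemPM v ℳ → MemPM (negᵥ v) ℳ
MemPM-neg = Any.map λ where
  (inj₁ v≗b)  → inj₂ (λ i → cong ℤ.-_ (v≗b i))
  (inj₂ v≗-b) → inj₁ (λ i → trans (cong ℤ.-_ (v≗-b i)) (ℤ.neg-involutive _))

diff : (Fin N → ℕ) → (Fin N → ℕ) → Vecℤ N
diff w u i = toℤᵥ w i ℤ.- toℤᵥ u i

diff-cong : {w w′ u u′ : Fin N → ℕ} → w ≗ w′ → u ≗ u′ → diff w u ≗ diff w′ u′
diff-cong w≗ u≗ i = cong₂ (λ a b → + a ℤ.- + b) (w≗ i) (u≗ i)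

diff-shift : (c w u : Fin N → ℕ) → diff (λ i → c i + w i) (λ i → c i + u i) ≗ diff w u
diff-shift c w u i = cancel (+ c i) (+ w i) (+ u i)
  where
  cancel : ∀ (c w u : ℤ) → (c ℤ.+ w) ℤ.- (c ℤ.+ u) ≡ w ℤ.- u
  cancel = solve-∀

neg-diff : (w u : Fin N → ℕ) → negᵥ (diff w u) ≗ diff u w
neg-diff w u i = ℤ-neg-minus (+ w i) (+ u i)
  where
  ℤ-neg-minus : ∀ (a b : ℤ) → ℤ.- (a ℤ.- b) ≡ b ℤ.- a
  ℤ-neg-minus = solve-∀

Step : List (Vecℤ N) → (w u : Fin N → ℕ) → Set
Step ℳ w u = MemPM (diff w u) ℳ

-- Walks in a fiber. The vertices are vectors over `ℕ`, so the nonnegativity of the partial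
-- differences in a Markov basis is built in.
data Conn (ℳ : List (Vecℤ N)) : (w u : Fin N → ℕ) → Set where
  done : ∀ {w u} → w ≗ u → Conn ℳ w u
  step : ∀ {w w′ u} → Step ℳ w w′ → Conn ℳ w′ u → Conn ℳ w u

module _ {ℳ : List (Vecℤ N)} where

  Step-resp : {w w′ u u′ : Fin N → ℕ} → w ≗ w′ → u ≗ u′ → Step ℳ w u → Step ℳ w′ u′
  Step-resp w≗ u≗ = MemPM-resp (diff-cong w≗ u≗)

  Conn-respˡ : {w w′ u : Fin N → ℕ} → w ≗ w′ → Conn ℳ w u → Conn ℳ w′ u
  Conn-respˡ w≗ (done w≗u) = done (λ i → trans (sym (w≗ i)) (w≗u i))
  Conn-respˡ w≗ (step {w′ = x} s c) = step (Step-resp {u = x} w≗ (λ _ → refl) s) c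

  Conn-trans : {w x u : Fin N → ℕ} → Conn ℳ w x → Conn ℳ x u → Conn ℳ w u
  Conn-trans (done w≗x) d = Conn-respˡ (sym ∘ w≗x) d
  Conn-trans (step s c) d = step s (Conn-trans c d)

  Conn-sym : {w u : Fin N → ℕ} → Conn ℳ w u → Conn ℳ u w
  Conn-sym (done w≗u) = done (sym ∘ w≗u)
  Conn-sym (step {w} {w′} s c) =
    Conn-trans (Conn-sym c) (step (MemPM-resp (neg-diff w w′) (MemPM-neg s)) (done (λ _ → refl)))

  Conn-resp : {w w′ u u′ : Fin N → ℕ} → w ≗ w′ → u ≗ u′ → Conn ℳ w u → Conn ℳ w′ u′
  Conn-resp w≗ u≗ c = Conn-trans (Conn-respˡ w≗ c) (done u≗)

  Conn-shift : (c : Fin N → ℕ) {w u : Fin N → ℕ} → Conn ℳ w u → Conn ℳ (λ i → c i + w i) (λ i → c i + u i)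
  Conn-shift c (done w≗u)          = done (λ i → cong (_+_ (c i)) (w≗u i))
  Conn-shift c (step {w} {w′} s d) = step (MemPM-resp (sym ∘ diff-shift c w w′) s) (Conn-shift c d)

Conn-bind : {ℳ ℳ′ : List (Vecℤ N)} → (∀ {w u} → Step ℳ w u → Conn ℳ′ w u) →
            ∀ {w u} → Conn ℳ w u → Conn ℳ′ w u
Conn-bind f (done w≗u) = done w≗u
Conn-bind f (step s c) = Conn-trans (f s) (Conn-bind f c)

pos-nonpos : ∀ a → pos (ℤ.- + a) ≡ 0
pos-nonpos zero    = refl
pos-nonpos (suc a) = refl

-- `pos z` and `neg z` form the least pair with difference `z`. Every other such pair is a translate
-- of it, by `w ∸ pos z`, which is the minimum of `w` and `u`.
common-part : ∀ w u z → + w ℤ.- + u ≡ z → (w ∸ pos z) + pos z ≡ w × (w ∸ pos z) + neg z ≡ u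
common-part w u z refl with ℕ.≤-total u w
... | inj₁ u≤w = subst (λ z → (w ∸ pos z) + pos z ≡ w × (w ∸ pos z) + neg z ≡ u)
                       (sym (trans (ℤ.m-n≡m⊖n w u) (ℤ.⊖-≥ u≤w)))
                       ( ℕ.m∸n+n≡m (ℕ.m∸n≤m w u)
                       , trans (cong₂ _+_ (ℕ.m∸[m∸n]≡n u≤w) (pos-nonpos (w ∸ u))) (ℕ.+-identityʳ u))
... | inj₂ w≤u = subst (λ z → (w ∸ pos z) + pos z ≡ w × (w ∸ pos z) + neg z ≡ u)
                       (sym (trans (ℤ.m-n≡m⊖n w u) (ℤ.⊖-≤ w≤u)))
                       ( trans (cong (λ a → (w ∸ a) + a) (pos-nonpos (u ∸ w))) (ℕ.+-identityʳ w)
                       , trans (cong₂ _+_ (cong (w ∸_) (pos-nonpos (u ∸ w))) (cong pos (ℤ.neg-involutive (+ (u ∸ w)))))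
                               (ℕ.m+[n∸m]≡n w≤u))

-- Walks can be translated, so connecting this least pair connects all pairs with difference `b`.
-- This leaves one test for each `b`.
Connects : List (Vecℤ N) → Vecℤ N → Set
Connects ℳ b = Conn ℳ (pos ∘ b) (neg ∘ b)

Connects⇒Conn : {ℳ : List (Vecℤ N)} {b : Vecℤ N} → Connects ℳ b → ∀ {w u} → diff w u ≗ b → Conn ℳ w u
Connects⇒Conn {b = b} c {w} {u} w-u≗b =
  Conn-resp (λ i → proj₁ (common-part (w i) (u i) (b i) (w-u≗b i)))
            (λ i → proj₂ (common-part (w i) (u i) (b i) (w-u≗b i)))
            (Conn-shift (λ i → w i ∸ pos (b i)) c)

Connects⇒bind : {ℳ ℳ′ : List (Vecℤ N)} → All (Connects ℳ′) ℳ → ∀ {w u} → Conn ℳ w u → Conn ℳ′ w u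
Connects⇒bind {ℳ = ℳ} {ℳ′} cs = Conn-bind (λ s → All.lookupWith connect cs s)
  where
  connect : ∀ {w u b} → Connects ℳ′ b → diff w u ≗ b ⊎ diff w u ≗ negᵥ b → Conn ℳ′ w u
  connect c (inj₁ w-u≗b) = Connects⇒Conn c w-u≗b
  connect {w} {u} c (inj₂ w-u≗-b) = Conn-sym (Connects⇒Conn c λ i →
    trans (sym (neg-diff w u i)) (trans (cong ℤ.-_ (w-u≗-b i)) (ℤ.neg-involutive _)))

InKer-cong : (M : Matrix m N) {v w : Vecℤ N} → v ≗ w → InKer M v → InKer M w
InKer-cong M v≗w v∈ i = trans (Σℤ-cong (λ j → cong (M i j ℤ.*_) (sym (v≗w j)))) (v∈ i)

IsConnecting : Matrix m N → List (Vecℤ N) → Set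
IsConnecting M ℳ = ∀ w u → InKer M (diff w u) → Conn ℳ w u

Path : List (Vecℤ N) → (w u : Fin N → ℕ) → Set
Path {N} ℳ w u = Σ (List (Vecℤ N)) λ vs →
  All (λ v → MemPM v ℳ) vs ×
  (∀ (l : ℕ) → l ≤ length vs → ∀ i → + 0 ℤ.≤ toℤᵥ w i ℤ.- sumᵥ (List.take l vs) i) ×
  (∀ i → toℤᵥ w i ℤ.- toℤᵥ u i ≡ sumᵥ vs i)

regroup : ∀ (w v s : ℤ) → w ℤ.- (v ℤ.+ s) ≡ (w ℤ.- v) ℤ.- s
regroup = solve-∀

Conn⇒Path : {ℳ : List (Vecℤ N)} {w u : Fin N → ℕ} → Conn ℳ w u → Path ℳ w u
Conn⇒Path {u = u} (done w≗u) = [] , [] ,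
  (λ { zero _ i → ℤ.+≤+ z≤n }) ,
  λ i → ℤ.i≡j⇒i-j≡0 (cong +_ (w≗u i))
Conn⇒Path {w = w} {u} (step {w′ = w′} s c) with Conn⇒Path c
... | vs , vs∈ , nonneg , total = diff w w′ ∷ vs , s ∷ vs∈ ,
  (λ { zero    _         i → ℤ.+≤+ z≤n
     ; (suc l) (s≤s l≤n) i → subst (+ 0 ℤ.≤_) (sym (drop (+ w i) (+ w′ i) (sumᵥ (List.take l vs) i))) (nonneg l l≤n i) }) ,
  λ i → trans (split (+ w i) (+ w′ i) (+ u i)) (cong (ℤ._+_ (diff w w′ i)) (total i))
  where
  drop : ∀ (w w′ s : ℤ) → w ℤ.- ((w ℤ.- w′) ℤ.+ s) ≡ w′ ℤ.- s
  drop = solve-∀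
  split : ∀ (w w′ u : ℤ) → w ℤ.- u ≡ (w ℤ.- w′) ℤ.+ (w′ ℤ.- u)
  split = solve-∀

Path⇒Conn : {ℳ : List (Vecℤ N)} {w u : Fin N → ℕ} (vs : List (Vecℤ N)) → All (λ v → MemPM v ℳ) vs →
            (∀ (l : ℕ) → l ≤ length vs → ∀ i → + 0 ℤ.≤ toℤᵥ w i ℤ.- sumᵥ (List.take l vs) i) →
            (∀ i → toℤᵥ w i ℤ.- toℤᵥ u i ≡ sumᵥ vs i) → Conn ℳ w u
Path⇒Conn [] _ _ total = done (λ i → ℤ.+-injective (ℤ.i-j≡0⇒i≡j _ _ (total i)))
Path⇒Conn {ℳ = ℳ} {w} {u} (v ∷ vs) (v∈ ∷ vs∈) nonneg total =
  step (MemPM-resp v≗ v∈) (Path⇒Conn vs vs∈ nonneg′ total′)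
  where
  -- The nonnegativity condition at `l = 1` says that the absolute value changes nothing here.
  w′ : Fin _ → ℕ
  w′ i = ℤ.∣ + w i ℤ.- v i ∣
  w′≡ : ∀ i → + w′ i ≡ + w i ℤ.- v i
  w′≡ i = ℤ.0≤i⇒+∣i∣≡i (subst (λ x → + 0 ℤ.≤ + w i ℤ.- x) (ℤ.+-identityʳ (v i)) (nonneg 1 (s≤s z≤n) i))
  solve-v : ∀ (w v : ℤ) → w ℤ.- (w ℤ.- v) ≡ v
  solve-v = solve-∀
  v≗ : v ≗ diff w w′
  v≗ i = sym (trans (cong (λ x → + w i ℤ.- x) (w′≡ i)) (solve-v (+ w i) (v i)))
  nonneg′ : ∀ l → l ≤ length vs → ∀ i → + 0 ℤ.≤ + w′ i ℤ.- sumᵥ (List.take l vs) i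
  nonneg′ l l≤n i = subst (+ 0 ℤ.≤_)
    (trans (regroup (+ w i) (v i) _) (cong (ℤ._- sumᵥ (List.take l vs) i) (sym (w′≡ i)))) (nonneg (suc l) (s≤s l≤n) i)
  swap : ∀ (w v u : ℤ) → (w ℤ.- v) ℤ.- u ≡ (w ℤ.- u) ℤ.- v
  swap = solve-∀
  cancel : ∀ (v s : ℤ) → (v ℤ.+ s) ℤ.- v ≡ s
  cancel = solve-∀
  total′ : ∀ i → + w′ i ℤ.- + u i ≡ sumᵥ vs i
  total′ i = trans (cong (ℤ._- + u i) (w′≡ i)) (trans (swap (+ w i) (v i) (+ u i))
               (trans (cong (ℤ._- v i) (total i)) (cancel (v i) _)))

module _ (M : Matrix m N) {ℳ : List (Vecℤ N)} where

  connecting⇒Markov : All (InKer M) ℳ → IsConnecting M ℳ → IsMarkovBasis M ℳ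
  connecting⇒Markov ker conn = ker , λ w u w-u∈ → Conn⇒Path (conn w u w-u∈)

  Markov⇒connecting : IsMarkovBasis M ℳ → IsConnecting M ℳ
  Markov⇒connecting (_ , path) w u w-u∈ with path w u w-u∈
  ... | vs , vs∈ , nonneg , total = Path⇒Conn vs vs∈ nonneg total

InKer-neg : (M : Matrix m N) {v : Vecℤ N} → InKer M v → InKer M (negᵥ v)
InKer-neg M {v} v∈ i = trans (Σℤ-cong (λ j → sym (ℤ.neg-distribʳ-* (M i j) (v j))))
                         (trans (Σℤ-neg (λ j → M i j ℤ.* v j)) (cong ℤ.-_ (v∈ i)))

Step⇒InKer : (M : Matrix m N) {ℳ : List (Vecℤ N)} → All (InKer M) ℳ → ∀ w u → Step ℳ w u → InKer M (diff w u)
Step⇒InKer M ker w u = All.lookupWith (λ where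
  b∈ (inj₁ v≗b)  → InKer-cong M (sym ∘ v≗b) b∈
  b∈ (inj₂ v≗-b) → InKer-cong M (sym ∘ v≗-b) (InKer-neg M b∈)) ker

-- A finite Markov basis: the differences w − u of the generators (w , u) of the monoid
-- {(w , u) : M w = M u}.

module _ (M : Matrix m N) where

  private
    left right : (Fin (N + N) → ℕ) → Fin N → ℕ
    left  x j = x (j ↑ˡ N)
    right x j = x (N ↑ʳ j)

    doubled : Matrix m (N + N)
    doubled i = [ M i , (λ j → ℤ.- M i j) ]′ ∘ splitAt N

    lin-doubled : ∀ i x → lin (doubled i) x ≡ Σℤ (λ j → M i j ℤ.* diff (left x) (right x) j)
    lin-doubled i x = trans (Σℤ-↑ N (λ j → doubled i j ℤ.* + x j))
      (trans (sym (Σℤ-+ (λ j → doubled i (j ↑ˡ N) ℤ.* + left x j) (λ j → doubled i (N ↑ʳ j) ℤ.* + right x j)))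
      (Σℤ-cong λ j → trans
        (cong₂ (λ a b → [ M i , (λ j → ℤ.- M i j) ]′ a ℤ.* + left x j ℤ.+ [ M i , (λ j → ℤ.- M i j) ]′ b ℤ.* + right x j)
               (splitAt-↑ˡ N j N) (splitAt-↑ʳ N N j))
        (factor (M i j) (+ left x j) (+ right x j))))
      where
      factor : ∀ (a x y : ℤ) → a ℤ.* x ℤ.+ (ℤ.- a) ℤ.* y ≡ a ℤ.* (x ℤ.- y)
      factor = solve-∀

    move : (Fin (N + N) → ℕ) → Vecℤ N
    move x = diff (left x) (right x)

    -- Each generator `g` in a decomposition of `x` is one step of the walk: it replaces the summand
    -- `left g` by `right g`. The rest of the walk is translated by `right g`.
    Gen⇒Conn : ∀ {G x} → Gen G x → Conn (List.map move G) (left x) (right x)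
    Gen⇒Conn (zero x≗0) = done (λ i → trans (x≗0 _) (sym (x≗0 _)))
    Gen⇒Conn {x = x} (plus {x′ = x′} x∈ gen) with find x∈
    ... | g , g∈G , x≗ = step {w′ = λ j → right g j + left x′ j}
      (Any.map⁺ (Any.map (λ { refl → inj₁ difference }) g∈G))
      (Conn-resp (λ _ → refl) (λ j → sym (x≗ (N ↑ʳ j))) (Conn-shift (right g) (Gen⇒Conn gen)))
      where
      cancel : ∀ (a b c : ℤ) → (a ℤ.+ c) ℤ.- (b ℤ.+ c) ≡ a ℤ.- b
      cancel = solve-∀
      difference : diff (left x) (λ j → right g j + left x′ j) ≗ move g
      difference j = trans (cong (λ a → + a ℤ.- + (right g j + left x′ j)) (x≗ (j ↑ˡ N)))
                           (cancel (+ left g j) (+ right g j) (+ left x′ j))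

  finite-Markov-basis : ∃ (IsMarkovBasis M)
  finite-Markov-basis with system-generated _ doubled
  ... | G , G-sol , G-gen = List.map move G , connecting⇒Markov M
    (All.map⁺ (All.map (λ {x} sol i → trans (sym (lin-doubled i x)) (sol i)) G-sol))
    λ w u w-u∈ →
      let x = [ w , u ]′ ∘ splitAt N
          w≗ : left x ≗ w
          w≗ j = cong [ w , u ]′ (splitAt-↑ˡ N j N)
          u≗ : right x ≗ u
          u≗ j = cong [ w , u ]′ (splitAt-↑ʳ N N j)
      in Conn-resp w≗ u≗ (Gen⇒Conn (G-gen x λ i →
           trans (lin-doubled i x) (InKer-cong M (sym ∘ diff-cong w≗ u≗) w-u∈ i)))

-- Deciding connectivity by the Floyd–Warshall recursion over the admissible intermediate vertices.

Reach : List (Vecℤ N) → List (Fin N → ℕ) → (w u : Fin N → ℕ) → Set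
Reach ℳ []      w u = w ≗ u ⊎ Step ℳ w u
Reach ℳ (z ∷ L) w u = Reach ℳ L w u ⊎ (Reach ℳ L w z × Reach ℳ L z u)

_≗ᵥ?_ : (v w : Vecℤ N) → Dec (v ≗ᵥ w)
v ≗ᵥ? w = Fin.all? (λ i → v i ℤ.≟ w i)

module _ (ℳ : List (Vecℤ N)) where

  Reach? : ∀ L w u → Dec (Reach ℳ L w u)
  Reach? []      w u = Fin.all? (λ i → w i ℕ.≟ u i) ⊎-dec
                       Any.any? (λ b → (diff w u ≗ᵥ? b) ⊎-dec (diff w u ≗ᵥ? negᵥ b)) ℳ
  Reach? (z ∷ L) w u = Reach? L w u ⊎-dec (Reach? L w z ×-dec Reach? L z u)

  Reach-resp : ∀ L {w w′ u u′} → w ≗ w′ → u ≗ u′ → Reach ℳ L w u → Reach ℳ L w′ u′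
  Reach-resp [] w≗ u≗ (inj₁ w≗u) = inj₁ (λ i → trans (sym (w≗ i)) (trans (w≗u i) (u≗ i)))
  Reach-resp [] w≗ u≗ (inj₂ s)   = inj₂ (Step-resp w≗ u≗ s)
  Reach-resp (z ∷ L) w≗ u≗ (inj₁ r)        = inj₁ (Reach-resp L w≗ u≗ r)
  Reach-resp (z ∷ L) w≗ u≗ (inj₂ (r , r′)) = inj₂ (Reach-resp L w≗ (λ _ → refl) r , Reach-resp L (λ _ → refl) u≗ r′)

  Reach⇒Conn : ∀ L {w u} → Reach ℳ L w u → Conn ℳ w u
  Reach⇒Conn []      (inj₁ w≗u)      = done w≗u
  Reach⇒Conn []      (inj₂ s)        = step s (done (λ _ → refl))
  Reach⇒Conn (z ∷ L) (inj₁ r)        = Reach⇒Conn L r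
  Reach⇒Conn (z ∷ L) (inj₂ (r , r′)) = Conn-trans (Reach⇒Conn L r) (Reach⇒Conn L r′)

  Reach-lift : ∀ L {w u} → Reach ℳ [] w u → Reach ℳ L w u
  Reach-lift []      r = r
  Reach-lift (z ∷ L) r = inj₁ (Reach-lift L r)

  -- If both walks pass through `z`, the part between the two visits is cut out, so that `z` is
  -- visited once.
  Reach-trans : ∀ L {w x u} → Any (x ≗_) L → Reach ℳ L w x → Reach ℳ L x u → Reach ℳ L w u
  Reach-trans (z ∷ L) (here x≗z) r r′ = inj₂ (to r , from r′)
    where
    to : ∀ {w} → Reach ℳ (z ∷ L) w _ → Reach ℳ L w z
    to (inj₁ r)       = Reach-resp L (λ _ → refl) x≗z r
    to (inj₂ (r , _)) = r
    from : ∀ {u} → Reach ℳ (z ∷ L) _ u → Reach ℳ L z u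
    from (inj₁ r)       = Reach-resp L x≗z (λ _ → refl) r
    from (inj₂ (_ , r)) = r
  Reach-trans (z ∷ L) (there x∈L) (inj₁ r)       (inj₁ s)        = inj₁ (Reach-trans L x∈L r s)
  Reach-trans (z ∷ L) (there x∈L) (inj₁ r)       (inj₂ (s , s′)) = inj₂ (Reach-trans L x∈L r s , s′)
  Reach-trans (z ∷ L) (there x∈L) (inj₂ (r , r′)) (inj₁ s)       = inj₂ (r , Reach-trans L x∈L r′ s)
  Reach-trans (z ∷ L) (there x∈L) (inj₂ (r , _)) (inj₂ (_ , s))  = inj₂ (r , s)

  Conn⇒Reach : ∀ {L d} → (∀ x → sum x ≡ d → Any (x ≗_) L) → (∀ {w u} → Step ℳ w u → sum w ≡ sum u) →
               ∀ {w u} → sum w ≡ d → Conn ℳ w u → Reach ℳ L w u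
  Conn⇒Reach {L} cover degree Σw≡d (done w≗u) = Reach-lift L (inj₁ w≗u)
  Conn⇒Reach {L} cover degree Σw≡d (step {w′ = w′} s c) =
    Reach-trans L (cover w′ Σw′≡d) (Reach-lift L (inj₂ s)) (Conn⇒Reach cover degree Σw′≡d c)
    where Σw′≡d = trans (sym (degree s)) Σw≡d

  -- Steps preserve the sum of the entries, so a walk from `w` stays in the box of side `sum w`. The
  -- vectors of this box suffice as intermediate vertices.
  Conn? : (∀ {w u} → Step ℳ w u → sum w ≡ sum u) → ∀ w u → Dec (Conn ℳ w u)
  Conn? degree w u = map′ (Reach⇒Conn L) (Conn⇒Reach cover degree refl) (Reach? L w u)
    where
    L = box N (sum w)
    cover : ∀ x → sum x ≡ sum w → Any (x ≗_) L
    cover x Σx≡Σw = ∈-box x (λ i → subst (x i ≤_) Σx≡Σw (term≤sum x i))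

-- Minimal Markov bases

-- The coordinate sum is then constant on each fiber, which makes the fibers finite.
Graded : Matrix m N → Set
Graded {N = N} M = (v : Vecℤ N) → InKer M v → Σℤ v ≡ + 0

Graded⇒sum≡ : (M : Matrix m N) → Graded M → ∀ w u → InKer M (diff w u) → sum w ≡ sum u
Graded⇒sum≡ M graded w u w-u∈ =
  ℤ.+-injective (ℤ.i-j≡0⇒i≡j _ _ (trans (sym (Σℤ-diff w u)) (graded _ w-u∈)))

-- All pointwise copies of `b` go, not one occurrence, because minimality speaks of lists as sets.
_without_ : List (Vecℤ N) → Vecℤ N → List (Vecℤ N)
ℳ without b = List.filter (λ c → ¬? (c ≗ᵥ? b)) ℳ

module _ (M : Matrix m N) (graded : Graded M) where

  -- A known Markov basis `ℳ` reduces the infinitely many pairs to finitely many: `ℳ′` only has to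
  -- connect the least pair of each element of `ℳ`.
  Markov? : ∀ {ℳ ℳ′} → IsMarkovBasis M ℳ → All (InKer M) ℳ′ → Dec (IsMarkovBasis M ℳ′)
  Markov? {ℳ} {ℳ′} basis ker′ = map′ to from
    (All.all? (λ b → Conn? ℳ′ (λ {w} {u} s → Graded⇒sum≡ M graded w u (Step⇒InKer M ker′ w u s)) (pos ∘ b) (neg ∘ b)) ℳ)
    where
    to : All (Connects ℳ′) ℳ → IsMarkovBasis M ℳ′
    to cs = connecting⇒Markov M ker′ (λ w u w-u∈ → Connects⇒bind cs (Markov⇒connecting M basis w u w-u∈))
    from : IsMarkovBasis M ℳ′ → All (Connects ℳ′) ℳ
    from basis′ = All.map (λ {b} b∈ → Markov⇒connecting M basis′ _ _ (InKer-cong M (sym ∘ pos-neg ∘ b) b∈)) (proj₁ basis)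

  minimize : ∀ fuel ℳ → length ℳ < fuel → IsMarkovBasis M ℳ → ∃ (IsMinimalMarkovBasis M)
  minimize (suc fuel) ℳ len basis
    with Any.any? (λ b → Markov? basis (All.filter⁺ (λ c → ¬? (c ≗ᵥ? b)) (proj₁ basis))) ℳ
  ... | yes redundant with find redundant
  ...   | b , b∈ℳ , basis′ = minimize fuel (ℳ without b) (ℕ.<-≤-trans shorter (ℕ.s≤s⁻¹ len)) basis′
    where
    shorter : length (ℳ without b) < length ℳ
    shorter = List.filter-notAll (λ c → ¬? (c ≗ᵥ? b)) ℳ (Any.map (λ { refl ¬b≗b → ¬b≗b (λ _ → refl) }) b∈ℳ)
  minimize (suc fuel) ℳ len basis | no irredundant = ℳ , basis , minimal
    where
    -- A Markov basis `ℳ′` inside `ℳ` that misses `v` lies in `ℳ without b` for the copy `b` of `v`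
    -- in `ℳ`. Then `ℳ without b` is a Markov basis too, and `b` would have been redundant.
    minimal : ∀ ℳ′ → (∀ v → Mem v ℳ′ → Mem v ℳ) → (Σ (Vecℤ N) λ v → Mem v ℳ × ¬ Mem v ℳ′) → ¬ IsMarkovBasis M ℳ′
    minimal ℳ′ ℳ′⊆ℳ (v , v∈ℳ , v∉ℳ′) basis′ with find v∈ℳ
    ... | b , b∈ℳ , v≗b = irredundant (Any.map (λ { refl → connecting⇒Markov M
        (All.filter⁺ (λ c → ¬? (c ≗ᵥ? b)) (proj₁ basis))
        (λ w u w-u∈ → Conn-bind (λ {w} {u} s → step {w = w} {w′ = u} (include s) (done (λ _ → refl)))
                               (Markov⇒connecting M basis′ w u w-u∈)) }) b∈ℳ)
      where
      survives : ∀ {c} → c ∈ ℳ′ → Mem c (ℳ without b)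
      survives {c} c∈ℳ′ with ℳ′⊆ℳ c (Any.map (λ { refl _ → refl }) c∈ℳ′)
      ... | c∈ℳ with Any.filter⁺ (λ c → ¬? (c ≗ᵥ? b)) c∈ℳ
      ...   | inj₁ c∈ = c∈
      ...   | inj₂ ¬¬c≗b = ⊥-elim (¬¬c≗b λ c′≗b → v∉ℳ′ (Any.map
              (λ { refl i → trans (v≗b i) (sym (trans (Any.lookup-result c∈ℳ i) (c′≗b i))) }) c∈ℳ′))
      include : ∀ {x} → MemPM x ℳ′ → MemPM x (ℳ without b)
      include x∈ with find x∈
      ... | c , c∈ℳ′ , inj₁ x≗c  = Any.map (λ c≗ → inj₁ (λ i → trans (x≗c i) (c≗ i))) (survives c∈ℳ′)
      ... | c , c∈ℳ′ , inj₂ x≗-c = Any.map (λ c≗ → inj₂ (λ i → trans (x≗-c i) (cong ℤ.-_ (c≗ i)))) (survives c∈ℳ′)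

  minimal-Markov-basis : ∃ (IsMinimalMarkovBasis M)
  minimal-Markov-basis with finite-Markov-basis M
  ... | ℳ , basis = minimize (suc (length ℳ)) ℳ ℕ.≤-refl basis

-- A walk from `P` to `Q` has a first step that leaves `P`. With only two points in the fiber it
-- ends at `Q`, so the move itself is `diff P Q`.
indispensable : (M : Matrix m N) (P Q : Fin N → ℕ) → ¬ P ≗ Q → InKer M (diff P Q) →
                (∀ u → InKer M (diff P u) → u ≗ P ⊎ u ≗ Q) →
                ∀ ℳ → IsMarkovBasis M ℳ → MemPM (diff P Q) ℳ
indispensable M P Q P≢Q P-Q∈ fiber ℳ basis =
  go (λ _ → refl) (Markov⇒connecting M basis P Q P-Q∈)
  where
  go : ∀ {w} → w ≗ P → Conn ℳ w Q → MemPM (diff P Q) ℳ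
  go w≗P (done w≗Q) = ⊥-elim (P≢Q (λ i → trans (sym (w≗P i)) (w≗Q i)))
  go {w} w≗P (step {w′ = w′} s c)
    with fiber w′ (InKer-cong M (diff-cong {u = w′} w≗P (λ _ → refl)) (Step⇒InKer M (proj₁ basis) w w′ s))
  ... | inj₁ w′≗P = go w′≗P c
  ... | inj₂ w′≗Q = Step-resp w≗P w′≗Q s

indispensable⇒universal : (M : Matrix m N) → Graded M → (P Q : Fin N → ℕ) → ¬ P ≗ Q → InKer M (diff P Q) →
                          (∀ u → InKer M (diff P u) → u ≗ P ⊎ u ≗ Q) → InUniversalMarkovBasis M (diff P Q)
indispensable⇒universal M graded P Q P≢Q P-Q∈ fiber with minimal-Markov-basis M graded
... | ℳ , minimal = ℳ , minimal , indispensable M P Q P≢Q P-Q∈ fiber ℳ (proj₁ minimal)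

-- The kernel of a Lawrence lifting

-- `remQuot` reduces to a swap of `quotRem`, and it is the latter that the rewriting below meets.
quotRem-combine : (k : Fin r) (l : Fin n) → Fin.quotRem {r} n (combine k l) ≡ (l , k)
quotRem-combine k l = cong Product.swap (Fin.remQuot-combine k l)

module _ (A : Matrix m n) (r : ℕ) where

  lawrence-block : ∀ k a j l → lawrence A r (combine k a ↑ˡ n) (combine j l) ≡ (if k ==F j then A a l else + 0)
  lawrence-block k a j l
    rewrite quotRem-combine {r} {n} j l | splitAt-↑ˡ (r ℕ.* m) (combine k a) n | quotRem-combine {r} {m} k a = refl

  lawrence-identity : ∀ c j l → lawrence A r ((r ℕ.* m) ↑ʳ c) (combine j l) ≡ (if c ==F l then + 1 else + 0)
  lawrence-identity c j l
    rewrite quotRem-combine {r} {n} j l | splitAt-↑ʳ (r ℕ.* m) n c = refl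

  module _ (v : Vecℤ (r ℕ.* n)) where

    lawrence-row : ∀ k a → Σℤ (λ i → lawrence A r (combine k a ↑ˡ n) i ℤ.* v i) ≡ Σℤ (λ l → A a l ℤ.* v (combine k l))
    lawrence-row k a = trans (Σℤ-combine r _)
      (trans (Σℤ-single k _ λ j j≢k → Σℤ-zero _ λ l → trans (entry j l) (cong (λ b → (if b then A a l else + 0) ℤ.* v (combine j l))
                                                                         (dec-false (k Fin.≟ j) (j≢k ∘ sym))))
             (Σℤ-cong λ l → trans (entry k l) (cong (λ b → (if b then A a l else + 0) ℤ.* v (combine k l))
                                                    (dec-true (k Fin.≟ k) refl))))
      where
      entry : ∀ j l → lawrence A r (combine k a ↑ˡ n) (combine j l) ℤ.* v (combine j l) ≡
                      (if k ==F j then A a l else + 0) ℤ.* v (combine j l)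
      entry j l = cong (ℤ._* v (combine j l)) (lawrence-block k a j l)

    lawrence-col : ∀ c → Σℤ (λ i → lawrence A r ((r ℕ.* m) ↑ʳ c) i ℤ.* v i) ≡ Σℤ {r} (λ j → v (combine j c))
    lawrence-col c = trans (Σℤ-combine r _) (Σℤ-cong λ j →
      trans (Σℤ-single c _ (λ l l≢c → trans (entry j l) (cong (λ b → (if b then + 1 else + 0) ℤ.* v (combine j l))
                                                             (dec-false (c Fin.≟ l) (l≢c ∘ sym)))))
            (trans (entry j c) (trans (cong (λ b → (if b then + 1 else + 0) ℤ.* v (combine j c)) (dec-true (c Fin.≟ c) refl))
                                      (ℤ.*-identityˡ _))))
      where
      entry : ∀ j l → lawrence A r ((r ℕ.* m) ↑ʳ c) (combine j l) ℤ.* v (combine j l) ≡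
                      (if c ==F l then + 1 else + 0) ℤ.* v (combine j l)
      entry j l = cong (ℤ._* v (combine j l)) (lawrence-identity c j l)

    lawrence-ker⁺ : (∀ k a → Σℤ (λ l → A a l ℤ.* v (combine k l)) ≡ + 0) →
                    (∀ c → Σℤ {r} (λ j → v (combine j c)) ≡ + 0) → InKer (lawrence A r) v
    lawrence-ker⁺ rows cols i = subst Orthogonal (Fin.join-splitAt (r ℕ.* m) n i) (orthogonal (splitAt (r ℕ.* m) i))
      where
      Orthogonal : Fin (r ℕ.* m ℕ.+ n) → Set
      Orthogonal i = Σℤ (λ j → lawrence A r i j ℤ.* v j) ≡ + 0
      orthogonal : ∀ s → Orthogonal (Fin.join (r ℕ.* m) n s)
      orthogonal (inj₂ c) = trans (lawrence-col c) (cols c)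
      orthogonal (inj₁ i) with Fin.combine-surjective {r} {m} i
      ... | k , a , refl = trans (lawrence-row k a) (rows k a)

  -- The sum of all entries is the sum of the column sums, and these vanish by the block row of
  -- identity matrices.
  lawrence-graded : Graded (lawrence A r)
  lawrence-graded v v∈ = trans (Σℤ-combine r v) (trans (Σℤ-swap (λ j c → v (combine {r} j c)))
    (Σℤ-zero _ (λ c → trans (sym (lawrence-col v c)) (v∈ ((r ℕ.* m) ↑ʳ c)))))

Σℤ-*-diff : (e x y : Fin n → ℕ) →
            Σℤ (λ l → + e l ℤ.* (+ x l ℤ.- + y l)) ≡ + sum (λ l → e l * x l) ℤ.- + sum (λ l → e l * y l)
Σℤ-*-diff e x y = trans
  (Σℤ-cong (λ l → trans (distrib (+ e l) (+ x l) (+ y l)) (sym (cong₂ ℤ._-_ (ℤ.pos-* (e l) (x l)) (ℤ.pos-* (e l) (y l))))))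
  (Σℤ-diff (λ l → e l * x l) (λ l → e l * y l))
  where
  distrib : ∀ (e x y : ℤ) → e ℤ.* (x ℤ.- y) ≡ e ℤ.* x ℤ.- e ℤ.* y
  distrib = solve-∀

module _ (e : Fin m → Fin n → ℕ) (r : ℕ) (w u : Fin (r ℕ.* n) → ℕ) where

  private
    M = lawrence (λ a l → + e a l) r

  lawrence-fiber⁺ : (∀ k a → sum (λ l → e a l * w (combine k l)) ≡ sum (λ l → e a l * u (combine k l))) →
                    (∀ l → sum {r} (λ k → w (combine k l)) ≡ sum {r} (λ k → u (combine k l))) →
                    InKer M (diff w u)
  lawrence-fiber⁺ rows cols = lawrence-ker⁺ _ r (diff w u)
    (λ k a → trans (Σℤ-*-diff (e a) (λ l → w (combine k l)) (λ l → u (combine k l))) (ℤ.i≡j⇒i-j≡0 (cong +_ (rows k a))))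
    (λ l → trans (Σℤ-diff {r} (λ k → w (combine k l)) (λ k → u (combine k l))) (ℤ.i≡j⇒i-j≡0 (cong +_ (cols l))))

  lawrence-fiber⁻-row : InKer M (diff w u) →
                        ∀ k a → sum (λ l → e a l * w (combine k l)) ≡ sum (λ l → e a l * u (combine k l))
  lawrence-fiber⁻-row w-u∈ k a = ℤ.+-injective (ℤ.i-j≡0⇒i≡j _ _
    (trans (sym (trans (lawrence-row _ r (diff w u) k a) (Σℤ-*-diff (e a) (λ l → w (combine k l)) (λ l → u (combine k l)))))
           (w-u∈ (combine k a ↑ˡ n))))

  lawrence-fiber⁻-col : InKer M (diff w u) →
                        ∀ l → sum {r} (λ k → w (combine k l)) ≡ sum {r} (λ k → u (combine k l))
  lawrence-fiber⁻-col w-u∈ l = ℤ.+-injective (ℤ.i-j≡0⇒i≡j _ _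
    (trans (sym (trans (lawrence-col (λ a l → + e a l) r (diff w u) l)
                       (Σℤ-diff {r} (λ k → w (combine k l)) (λ k → u (combine k l)))))
           (w-u∈ ((r ℕ.* m) ↑ʳ l))))

count-all : (b : Fin k → Bool) → (∀ i → b i ≡ true) → count b ≡ k
count-all {zero}  b all = refl
count-all {suc k} b all rewrite all Fin.zero = cong suc (count-all (b ∘ Fin.suc) (all ∘ Fin.suc))

anyFin-at : (b : Fin k → Bool) (i : Fin k) → b i ≡ true → anyFin b ≡ true
anyFin-at b Fin.zero    bi rewrite bi = refl
anyFin-at b (Fin.suc i) bi rewrite anyFin-at (b ∘ Fin.suc) i bi = Bool.∨-zeroʳ _

typeOf-full : ∀ r (v : Vecℤ (r ℕ.* n)) (l : Fin n) → (∀ k → v (combine k l) ≢ + 0) → typeOf r v ≡ r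
typeOf-full r v l v≢0 = count-all _ λ k → anyFin-at _ l (cong not (dec-false (v (combine k l) ℤ.≟ + 0) (v≢0 k)))

-- The matrix and its rank

-- The residue modulo δ t of the value of a vector under row 0 is its sum, as long as that is small.
δ : ℕ → ℕ
δ t = 5 + 4 * t

-- Row 0 is the all-ones vector plus `δ t` times row 1 on the first four columns. Rows from 2 on are
-- unit vectors in the columns from 4 on: they raise the rank and leave the first four columns
-- alone.
entry : (t row col : ℕ) → ℕ
entry t 0 0 = 1
entry t 0 1 = 1 + δ t
entry t 0 2 = 1 + δ t * (1 + t)
entry t 0 3 = 1 + δ t * (2 + t)
entry t 0 (suc (suc (suc (suc _)))) = 0
entry t 1 0 = 0
entry t 1 1 = 1
entry t 1 2 = 1 + t
entry t 1 3 = 2 + t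
entry t 1 (suc (suc (suc (suc _)))) = 0
entry t (suc (suc i)) l = if does (l ℕ.≟ 4 + i) then 1 else 0

-- Zero rows from `d` on pad a matrix of rank `d` to any larger number of rows.
cell : (t d row col : ℕ) → ℕ
cell t d i l = if does (i ℕ.<? d) then entry t i l else 0

example : ∀ t d m n → Matrix m n
example t d m n a l = + cell t d (toℕ a) (toℕ l)

cell-< : ∀ t {d i} l → i < d → cell t d i l ≡ entry t i l
cell-< t {d} {i} l i<d = cong (λ b → if b then entry t i l else 0) (dec-true (i ℕ.<? d) i<d)

cell-≥ : ∀ t {d i} l → ¬ i < d → cell t d i l ≡ 0
cell-≥ t {d} {i} l i≮d = cong (λ b → if b then entry t i l else 0) (dec-false (i ℕ.<? d) i≮d)

-- Elimination by pivots equal to 1: column 0 for row 0, then column 1 for row 1, where only row 0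
-- interferes, and column `4 + k` for row `2 + k`.
example-independent : ∀ t {d m n} → 4 ≤ n → d + 2 ≤ n → (d≤m : d ≤ m) →
                      RowsIndependent (example t d m n) (λ j → inject≤ j d≤m)
example-independent t {d} {m} {suc (suc (suc (suc n)))} (s≤s (s≤s (s≤s (s≤s _)))) d+2≤n d≤m =
  (λ i j → Fin.inject≤-injective d≤m d≤m i j) , coefficient
  where
  module _ (c : Fin d → ℤ) (zero-comb : CombZero (example t d m (4 + n)) (λ j → inject≤ j d≤m) c) where
    comb≡0 : ∀ col → Σℤ (λ j → c j ℤ.* + entry t (toℕ j) (toℕ col)) ≡ + 0
    comb≡0 col = trans (Σℤ-cong λ j → cong (λ a → c j ℤ.* + a)
      (sym (trans (cong (λ i → cell t d i (toℕ col)) (Fin.toℕ-inject≤ j d≤m)) (cell-< t (toℕ col) (Fin.toℕ<n j)))))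
      (zero-comb col)

    isolate : ∀ j col → entry t (toℕ j) (toℕ col) ≡ 1 →
              (∀ i → i ≢ j → c i ≡ + 0 ⊎ entry t (toℕ i) (toℕ col) ≡ 0) → c j ≡ + 0
    isolate j col pivot others = trans (sym (ℤ.*-identityʳ (c j))) (trans (cong (λ a → c j ℤ.* + a) (sym pivot))
      (trans (sym (Σℤ-single j _ λ i i≢j → vanish i (others i i≢j))) (comb≡0 col)))
      where
      vanish : ∀ i → c i ≡ + 0 ⊎ entry t (toℕ i) (toℕ col) ≡ 0 → c i ℤ.* + entry t (toℕ i) (toℕ col) ≡ + 0
      vanish i (inj₁ ci≡0) = cong (ℤ._* + entry t (toℕ i) (toℕ col)) ci≡0
      vanish i (inj₂ e≡0)  = trans (cong (λ a → c i ℤ.* + a) e≡0) (ℤ.*-zeroʳ (c i))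

    coefficient₀ : ∀ j → toℕ j ≡ 0 → c j ≡ + 0
    coefficient₀ j j≡0 = isolate j 0F (cong (λ i → entry t i 0) j≡0) λ i i≢j →
      inj₂ (zeros (toℕ i) (λ i≡0 → i≢j (Fin.toℕ-injective (trans i≡0 (sym j≡0)))))
      where
      zeros : ∀ i → i ≢ 0 → entry t i 0 ≡ 0
      zeros 0 i≢0 = ⊥-elim (i≢0 refl)
      zeros 1 _ = refl
      zeros (suc (suc i)) _ = refl

    coefficient₁ : ∀ j → toℕ j ≡ 1 → c j ≡ + 0
    coefficient₁ j j≡1 = isolate j 1F (cong (λ i → entry t i 1) j≡1) zeros
      where
      zeros : ∀ i → i ≢ j → c i ≡ + 0 ⊎ entry t (toℕ i) 1 ≡ 0
      zeros i i≢j with toℕ i in eq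
      ... | 0           = inj₁ (coefficient₀ i eq)
      ... | 1           = ⊥-elim (i≢j (Fin.toℕ-injective (trans eq (sym j≡1))))
      ... | suc (suc _) = inj₂ refl

    coefficient : ∀ j → c j ≡ + 0
    coefficient j with toℕ j in eq
    ... | 0 = coefficient₀ j eq
    ... | 1 = coefficient₁ j eq
    ... | suc (suc k) = isolate j (fromℕ< 4+k<n)
            (trans (cong₂ (entry t) eq (Fin.toℕ-fromℕ< 4+k<n))
              (cong (λ b → if b then 1 else 0) (dec-true (4 + k ℕ.≟ 4 + k) refl)))
            λ i i≢j → inj₂ (trans (cong (entry t (toℕ i)) (Fin.toℕ-fromℕ< 4+k<n))
              (zeros (toℕ i) (λ i≡j → i≢j (Fin.toℕ-injective (trans i≡j (sym eq))))))
      where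
      -- The pivot of row `2 + k` lies two columns right of the diagonal, which is where `d + 2 ≤ n`
      -- enters.
      4+k<n : 4 + k < 4 + n
      4+k<n = ℕ.≤-trans (subst (_≤ d + 2) (ℕ.+-comm (3 + k) 2) (ℕ.+-monoˡ-≤ 2 (subst (_< d) eq (Fin.toℕ<n j)))) d+2≤n
      zeros : ∀ i → i ≢ suc (suc k) → entry t i (4 + k) ≡ 0
      zeros 0 _ = refl
      zeros 1 _ = refl
      zeros (suc (suc i)) i≢k = cong (λ b → if b then 1 else 0)
        (dec-false (4 + k ℕ.≟ 4 + i) (λ eq → i≢k (sym (ℕ.+-cancelˡ-≡ 2 _ _ eq))))

-- Either one of the `suc d` chosen rows is a zero row, which carries a nontrivial relation, or all
-- lie among the first `d` and two coincide.
example-dependent : ∀ t {d m n} (g : Fin (suc d) → Fin m) → ¬ RowsIndependent (example t d m n) g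
example-dependent t {d} {m} {n} g (injective , independent) with Fin.any? (λ j → ¬? (toℕ (g j) ℕ.<? d))
... | yes (j , gj≮d) = 1≢0 (trans (sym (cong +_ (scaledUnit-≡ j 1))) (independent (λ i → + scaledUnit j 1 i) zero-comb j))
  where
  1≢0 : + 1 ≢ + 0
  1≢0 ()
  zero-comb : CombZero (example t d m n) g (λ i → + scaledUnit j 1 i)
  zero-comb col = Σℤ-zero _ λ i → term i
    where
    term : ∀ i → + scaledUnit j 1 i ℤ.* + cell t d (toℕ (g i)) (toℕ col) ≡ + 0
    term i with i Fin.≟ j
    ... | yes refl = trans (ℤ.*-identityˡ _) (cong +_ (cell-≥ t (toℕ col) gj≮d))
    ... | no _     = refl
... | no ¬large with Fin.pigeonhole ℕ.≤-refl (λ j → fromℕ< (small j))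
  where
  small : ∀ j → toℕ (g j) < d
  small j = decidable-stable (toℕ (g j) ℕ.<? d) (λ gj≮d → ¬large (j , gj≮d))
...   | i , j , i<j , eq = Fin.<⇒≢ i<j (injective i j (Fin.toℕ-injective (Fin.fromℕ<-injective _ _ _ _ eq)))

example-rank : ∀ t {d m n} → 4 ≤ n → d + 2 ≤ n → d ≤ m → HasRank (example t d m n) d
example-rank t 4≤n d+2≤n d≤m =
  ((λ j → inject≤ j d≤m) , example-independent t 4≤n d+2≤n d≤m) , example-dependent t

-- The fiber of the indispensable element

sum-zero : (f : Fin k → ℕ) → (∀ i → f i ≡ 0) → sum f ≡ 0
sum-zero {zero}  f f≗0 = refl
sum-zero {suc k} f f≗0 = cong₂ _+_ (f≗0 0F) (sum-zero (f ∘ Fin.suc) (f≗0 ∘ Fin.suc))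

sum-one : ∀ k → sum {k} (λ _ → 1) ≡ k
sum-one zero    = refl
sum-one (suc k) = cong suc (sum-one k)

all-zero : (f : Fin k → ℕ) → sum f ≡ 0 → ∀ i → f i ≡ 0
all-zero f Σf≡0 i = ℕ.n≤0⇒n≡0 (subst (f i ≤_) Σf≡0 (term≤sum f i))

sum≤ : (f : Fin k → ℕ) → (∀ i → f i ≤ 1) → sum f ≤ k
sum≤ {k} f f≤1 = subst (sum f ≤_) (sum-one k) (sum-mono f≤1)

all-one : (f : Fin k → ℕ) → (∀ i → f i ≤ 1) → sum f ≡ k → ∀ i → f i ≡ 1
all-one {suc k} f f≤1 Σf≡k i with f 0F in eq | f≤1 0F
... | 0 | _ = ⊥-elim (ℕ.<-irrefl Σf≡k (s≤s (sum≤ (f ∘ Fin.suc) (f≤1 ∘ Fin.suc))))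
all-one {suc k} f f≤1 Σf≡k 0F          | 1 | _ = eq
all-one {suc k} f f≤1 Σf≡k (Fin.suc i) | 1 | _ = all-one (f ∘ Fin.suc) (f≤1 ∘ Fin.suc) (ℕ.suc-injective Σf≡k) i
all-one f f≤1 Σf≡k i | suc (suc _) | s≤s ()

quad : (a b c d : ℕ) → Fin (4 + n) → ℕ
quad a b c d 0F = a
quad a b c d 1F = b
quad a b c d 2F = c
quad a b c d 3F = d
quad a b c d (Fin.suc (Fin.suc (Fin.suc (Fin.suc _)))) = 0

sum-first-four : (f : Fin (4 + n) → ℕ) → (∀ l → f (4 Fin.↑ʳ l) ≡ 0) → sum f ≡ f 0F + f 1F + f 2F + f 3F
sum-first-four f f≗0 = trans (cong (λ s → f 0F + (f 1F + (f 2F + (f 3F + s)))) (sum-zero (λ l → f (4 Fin.↑ʳ l)) f≗0))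
                             (assoc (f 0F) (f 1F) (f 2F) (f 3F))
  where
  assoc : ∀ a b c d → a + (b + (c + (d + 0))) ≡ a + b + c + d
  assoc = ℕ-Solver.solve-∀

-- Row by row the positive and negative parts of `v₀`, of `−(v₀ + t u)` and of `t` copies of `u`.
P Q : ∀ t → Fin (2 + t) → Fin (4 + n) → ℕ
P t 0F                    = quad 0 (1 + t) 0 0
P t 1F                    = quad 0 0 (1 + t) 0
P t (Fin.suc (Fin.suc _)) = quad 1 0 0 1
Q t 0F                    = quad t 0 1 0
Q t 1F                    = quad 0 1 0 t
Q t (Fin.suc (Fin.suc _)) = quad 0 1 1 0

total : ∀ t → Fin (4 + n) → ℕ
total t = quad t (1 + t) (1 + t) t

P-total : ∀ t (l : Fin (4 + n)) → sum (λ k → P t k l) ≡ total t l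
P-total t 0F = sum-one t
P-total t 1F = trans (cong (_+_ (1 + t)) (sum-zero {t} _ (λ _ → refl))) (ℕ.+-identityʳ _)
P-total t 2F = trans (cong (_+_ (1 + t)) (sum-zero {t} _ (λ _ → refl))) (ℕ.+-identityʳ _)
P-total t 3F = sum-one t
P-total t (Fin.suc (Fin.suc (Fin.suc (Fin.suc _)))) = sum-zero {t} _ (λ _ → refl)

Q-total : ∀ t (l : Fin (4 + n)) → sum (λ k → Q t k l) ≡ total t l
Q-total t 0F = trans (cong (_+_ t) (sum-zero {t} _ (λ _ → refl))) (ℕ.+-identityʳ _)
Q-total t 1F = cong suc (sum-one t)
Q-total t 2F = cong suc (sum-one t)
Q-total t 3F = trans (cong (_+_ t) (sum-zero {t} _ (λ _ → refl))) (ℕ.+-identityʳ _)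
Q-total t (Fin.suc (Fin.suc (Fin.suc (Fin.suc _)))) = sum-zero {t} _ (λ _ → refl)

tail-zero : ∀ (e : ℕ → ℕ) (f : Fin (4 + n) → ℕ) → (∀ l → f (4 Fin.↑ʳ l) ≡ 0) → ∀ l → e (4 + toℕ l) * f (4 Fin.↑ʳ l) ≡ 0
tail-zero e f f≗0 l = trans (cong (e (4 + toℕ l) *_) (f≗0 l)) (ℕ.*-zeroʳ (e (4 + toℕ l)))

P-tail : ∀ t k (l : Fin n) → P t k (4 ↑ʳ l) ≡ 0
P-tail t 0F                    l = refl
P-tail t 1F                    l = refl
P-tail t (Fin.suc (Fin.suc _)) l = refl

Q-tail : ∀ t k (l : Fin n) → Q t k (4 ↑ʳ l) ≡ 0
Q-tail t 0F                    l = refl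
Q-tail t 1F                    l = refl
Q-tail t (Fin.suc (Fin.suc _)) l = refl

P-Q-balanced : ∀ t d i k → sum (λ l → cell t d i (toℕ l) * P {n} t k l) ≡ sum (λ l → cell t d i (toℕ l) * Q {n} t k l)
P-Q-balanced {n} t d i k =
  trans (sum-first-four (λ l → cell t d i (toℕ l) * P t k l) (tail-zero (cell t d i) (P t k) (P-tail t k)))
  (trans four
  (sym (sum-first-four (λ l → cell t d i (toℕ l) * Q t k l) (tail-zero (cell t d i) (Q t k) (Q-tail t k)))))
  where
  value : (ℕ → ℕ) → (Fin (4 + n) → ℕ) → ℕ
  value e x = e 0 * x 0F + e 1 * x 1F + e 2 * x 2F + e 3 * x 3F
  -- This holds for every `δ`, because both the sums and the weights of the two sides agree.
  row₀ : ∀ t δ k → let v = λ (x : Fin (4 + n) → ℕ) → 1 * x 0F + (1 + δ) * x 1F + (1 + δ * (1 + t)) * x 2F + (1 + δ * (2 + t)) * x 3F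
                   in v (P t k) ≡ v (Q t k)
  row₀ t δ 0F = eq t δ
    where
    eq : ∀ t δ → 1 * 0 + (1 + δ) * (1 + t) + (1 + δ * (1 + t)) * 0 + (1 + δ * (2 + t)) * 0 ≡
                 1 * t + (1 + δ) * 0 + (1 + δ * (1 + t)) * 1 + (1 + δ * (2 + t)) * 0
    eq = ℕ-Solver.solve-∀
  row₀ t δ 1F = eq t δ
    where
    eq : ∀ t δ → 1 * 0 + (1 + δ) * 0 + (1 + δ * (1 + t)) * (1 + t) + (1 + δ * (2 + t)) * 0 ≡
                 1 * 0 + (1 + δ) * 1 + (1 + δ * (1 + t)) * 0 + (1 + δ * (2 + t)) * t
    eq = ℕ-Solver.solve-∀
  row₀ t δ (Fin.suc (Fin.suc _)) = eq t δ
    where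
    eq : ∀ t δ → 1 * 1 + (1 + δ) * 0 + (1 + δ * (1 + t)) * 0 + (1 + δ * (2 + t)) * 1 ≡
                 1 * 0 + (1 + δ) * 1 + (1 + δ * (1 + t)) * 1 + (1 + δ * (2 + t)) * 0
    eq = ℕ-Solver.solve-∀
  row₁ : ∀ t k → value (entry t 1) (P t k) ≡ value (entry t 1) (Q t k)
  row₁ t 0F = eq t
    where
    eq : ∀ t → 0 * 0 + 1 * (1 + t) + (1 + t) * 0 + (2 + t) * 0 ≡ 0 * t + 1 * 0 + (1 + t) * 1 + (2 + t) * 0
    eq = ℕ-Solver.solve-∀
  row₁ t 1F = eq t
    where
    eq : ∀ t → 0 * 0 + 1 * 0 + (1 + t) * (1 + t) + (2 + t) * 0 ≡ 0 * 0 + 1 * 1 + (1 + t) * 0 + (2 + t) * t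
    eq = ℕ-Solver.solve-∀
  row₁ t (Fin.suc (Fin.suc _)) = eq t
    where
    eq : ∀ t → 0 * 1 + 1 * 0 + (1 + t) * 0 + (2 + t) * 1 ≡ 0 * 0 + 1 * 1 + (1 + t) * 1 + (2 + t) * 0
    eq = ℕ-Solver.solve-∀
  rows : ∀ i → value (entry t i) (P t k) ≡ value (entry t i) (Q t k)
  rows 0             = row₀ t (δ t) k
  rows 1             = row₁ t k
  rows (suc (suc _)) = refl
  four : value (cell t d i) (P t k) ≡ value (cell t d i) (Q t k)
  four with does (i ℕ.<? d)
  ... | true  = rows i
  ... | false = refl

divMod-unique : ∀ δ {a b w v} → a < δ → b < δ → a + w * δ ≡ b + v * δ → a ≡ b × w ≡ v
divMod-unique δ@(suc _) {a} {b} {w} {v} a<δ b<δ eq = a≡b ,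
  ℕ.*-cancelʳ-≡ w v δ (ℕ.+-cancelˡ-≡ b (w * δ) (v * δ) (subst (λ a → a + w * δ ≡ b + v * δ) a≡b eq))
  where
  open ≡-Reasoning
  a≡b : a ≡ b
  a≡b = begin
    a                 ≡⟨ m<n⇒m%n≡m a<δ ⟨
    a % δ             ≡⟨ [m+kn]%n≡m%n a w δ ⟨
    (a + w * δ) % δ   ≡⟨ cong (_% δ) eq ⟩
    (b + v * δ) % δ   ≡⟨ [m+kn]%n≡m%n b v δ ⟩
    b % δ             ≡⟨ m<n⇒m%n≡m b<δ ⟩
    b                 ∎

Quad≡ : (x₀ x₁ x₂ x₃ a b c d : ℕ) → Set
Quad≡ x₀ x₁ x₂ x₃ a b c d = x₀ ≡ a × x₁ ≡ b × x₂ ≡ c × x₃ ≡ d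

-- The coefficient of `δ` in the value of a vector under row 0.
weight : (t x₁ x₂ x₃ : ℕ) → ℕ
weight t x₁ x₂ x₃ = x₁ + x₂ * (1 + t) + x₃ * (2 + t)

-- The weight `1 + t` leaves no room for `x₃` and at most one unit of `x₂`. Then the weight gives
-- `x₁` and the sum gives `x₀`.
end-row : ∀ t x₀ x₁ x₂ x₃ → x₀ + x₁ + x₂ + x₃ ≡ 1 + t → weight t x₁ x₂ x₃ ≡ 1 + t →
          Quad≡ x₀ x₁ x₂ x₃ 0 (1 + t) 0 0 ⊎ Quad≡ x₀ x₁ x₂ x₃ t 0 1 0
end-row t x₀ x₁ x₂ (suc x₃) sum≡ weight≡ = ⊥-elim (ℕ.<-irrefl (sym weight≡)
  (ℕ.≤-trans (ℕ.m≤m+n (2 + t) (x₃ * (2 + t))) (ℕ.m≤n+m _ (x₁ + x₂ * (1 + t)))))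
end-row t x₀ x₁ 0 0 sum≡ weight≡ = inj₁ (x₀≡0 , x₁≡ , refl , refl)
  where
  drop : ∀ a → a ≡ a + 0 + 0
  drop = ℕ-Solver.solve-∀
  x₁≡ = trans (drop x₁) weight≡
  x₀≡0 = ℕ.+-cancelʳ-≡ (1 + t) x₀ 0 (trans (cong (_+_ x₀) (sym x₁≡)) (trans (drop (x₀ + x₁)) sum≡))
end-row t x₀ x₁ 1 0 sum≡ weight≡ = inj₂ (x₀≡t , x₁≡0 , refl , refl)
  where
  move : ∀ x₁ t → x₁ + 1 * (1 + t) + 0 ≡ x₁ + (1 + t)
  move = ℕ-Solver.solve-∀
  x₁≡0 = ℕ.+-cancelʳ-≡ (1 + t) x₁ 0 (trans (sym (move x₁ t)) weight≡)
  shift : ∀ x₀ x₁ → 1 + (x₀ + x₁) ≡ x₀ + x₁ + 1 + 0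
  shift = ℕ-Solver.solve-∀
  x₀≡t = trans (sym (trans (cong (_+_ x₀) x₁≡0) (ℕ.+-identityʳ x₀))) (ℕ.suc-injective (trans (shift x₀ x₁) sum≡))
end-row t x₀ x₁ (suc (suc x₂)) 0 sum≡ weight≡ = ⊥-elim (ℕ.m+1+n≢m (1 + t) (trans (sym (expand t x₁ x₂)) weight≡))
  where
  expand : ∀ t x₁ x₂ → x₁ + (2 + x₂) * (1 + t) + 0 ≡ (1 + t) + suc (t + x₁ + x₂ * (1 + t))
  expand = ℕ-Solver.solve-∀

-- One unit of `x₃` exhausts the weight. Without it, `0 < t` excludes `x₂ ≥ 2`, whose weight is too
-- large, and `x₂ = 0`, which forces `x₁ = 2 + t` against the sum 2.
middle-row : ∀ t x₀ x₁ x₂ x₃ → 0 < t → x₀ + x₁ + x₂ + x₃ ≡ 2 → weight t x₁ x₂ x₃ ≡ 2 + t →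
             Quad≡ x₀ x₁ x₂ x₃ 1 0 0 1 ⊎ Quad≡ x₀ x₁ x₂ x₃ 0 1 1 0
middle-row t@(suc t′) x₀ x₁ x₂ (suc (suc x₃)) _ sum≡ weight≡ =
  ⊥-elim (ℕ.m+1+n≢m (2 + t) (trans (sym (expand t x₁ x₂ x₃)) weight≡))
  where
  expand : ∀ t x₁ x₂ x₃ → x₁ + x₂ * (1 + t) + (2 + x₃) * (2 + t) ≡ (2 + t) + suc (1 + t + x₁ + x₂ * (1 + t) + x₃ * (2 + t))
  expand = ℕ-Solver.solve-∀
middle-row t@(suc t′) x₀ x₁ (suc x₂) 1 _ sum≡ weight≡ =
  ⊥-elim (ℕ.m+1+n≢m (2 + t) (trans (sym (expand t x₁ x₂)) weight≡))
  where
  expand : ∀ t x₁ x₂ → x₁ + (1 + x₂) * (1 + t) + 1 * (2 + t) ≡ (2 + t) + suc (t + x₁ + x₂ * (1 + t))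
  expand = ℕ-Solver.solve-∀
middle-row t@(suc t′) x₀ x₁ 0 1 _ sum≡ weight≡ = inj₁ (x₀≡1 , x₁≡0 , refl , refl)
  where
  move : ∀ t x₁ → x₁ + 0 * (1 + t) + 1 * (2 + t) ≡ x₁ + (2 + t)
  move = ℕ-Solver.solve-∀
  x₁≡0 = ℕ.+-cancelʳ-≡ (2 + t) x₁ 0 (trans (sym (move t x₁)) weight≡)
  shift : ∀ x₀ x₁ → 1 + (x₀ + x₁) ≡ x₀ + x₁ + 0 + 1
  shift = ℕ-Solver.solve-∀
  x₀≡1 = trans (sym (trans (cong (_+_ x₀) x₁≡0) (ℕ.+-identityʳ x₀))) (ℕ.suc-injective (trans (shift x₀ x₁) sum≡))
middle-row t@(suc t′) x₀ x₁ 0 0 _ sum≡ weight≡ = ⊥-elim (ℕ.m+1+n≢m 2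
  (trans (sym (trans (cong (λ a → x₀ + a + 0 + 0) x₁≡) (expand t′ x₀))) sum≡))
  where
  drop : ∀ a → a ≡ a + 0 + 0
  drop = ℕ-Solver.solve-∀
  x₁≡ = trans (drop x₁) weight≡
  expand : ∀ t′ x₀ → x₀ + (2 + suc t′) + 0 + 0 ≡ 2 + suc (t′ + x₀)
  expand = ℕ-Solver.solve-∀
middle-row t@(suc t′) x₀ x₁ 1 0 _ sum≡ weight≡ = inj₂ (x₀≡0 , x₁≡1 , refl , refl)
  where
  move : ∀ t x₁ → x₁ + 1 * (1 + t) + 0 * (2 + t) ≡ x₁ + (1 + t)
  move = ℕ-Solver.solve-∀
  x₁≡1 = ℕ.+-cancelʳ-≡ (1 + t) x₁ 1 (trans (sym (move t x₁)) weight≡)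
  shift : ∀ x₀ → x₀ + 2 ≡ x₀ + 1 + 1 + 0
  shift = ℕ-Solver.solve-∀
  x₀≡0 = ℕ.+-cancelʳ-≡ 2 x₀ 0 (trans (shift x₀) (trans (cong (λ a → x₀ + a + 1 + 0) (sym x₁≡1)) sum≡))
middle-row t@(suc t′) x₀ x₁ (suc (suc x₂)) 0 _ sum≡ weight≡ =
  ⊥-elim (ℕ.m+1+n≢m (2 + t) (trans (sym (expand t′ x₁ x₂)) weight≡))
  where
  expand : ∀ t′ x₁ x₂ → x₁ + (2 + x₂) * (1 + suc t′) + 0 ≡ (2 + suc t′) + suc (t′ + x₁ + x₂ * (1 + suc t′))
  expand = ℕ-Solver.solve-∀

row₀-value : ∀ t δ x₀ x₁ x₂ x₃ →
             1 * x₀ + (1 + δ) * x₁ + (1 + δ * (1 + t)) * x₂ + (1 + δ * (2 + t)) * x₃ ≡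
             (x₀ + x₁ + x₂ + x₃) + weight t x₁ x₂ x₃ * δ
row₀-value = eq
  where
  eq : ∀ t δ x₀ x₁ x₂ x₃ →
       1 * x₀ + (1 + δ) * x₁ + (1 + δ * (1 + t)) * x₂ + (1 + δ * (2 + t)) * x₃ ≡
       (x₀ + x₁ + x₂ + x₃) + (x₁ + x₂ * (1 + t) + x₃ * (2 + t)) * δ
  eq = ℕ-Solver.solve-∀

row₀-sum : ∀ t d (x : Fin (4 + n) → ℕ) → sum (λ l → cell t (suc d) 0 (toℕ l) * x l) ≡
           (x 0F + x 1F + x 2F + x 3F) + weight t (x 1F) (x 2F) (x 3F) * δ t
row₀-sum t d x = trans (sum-first-four (λ l → cell t (suc d) 0 (toℕ l) * x l) (λ _ → refl))
                       (row₀-value t (δ t) (x 0F) (x 1F) (x 2F) (x 3F))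

module _ {n t : ℕ} (0<t : 0 < t) (u : Fin (2 + t) → Fin (4 + n) → ℕ) (d : ℕ)
         (rows : ∀ k → sum (λ l → cell t (suc d) 0 (toℕ l) * P {n} t k l) ≡
                       sum (λ l → cell t (suc d) 0 (toℕ l) * u k l))
         (cols : ∀ (l : Fin (4 + n)) → sum (λ k → P {n} t k l) ≡ sum (λ k → u k l)) where

  private
    column : ∀ l → sum (λ k → u k l) ≡ total t l
    column l = trans (sym (cols l)) (P-total t l)

    u≤total : ∀ k l → u k l ≤ total t l
    u≤total k l = subst (u k l ≤_) (column l) (term≤sum (λ k → u k l) k)

    degree< : ∀ (x : Fin (4 + n) → ℕ) → (∀ l → x l ≤ total {n} t l) → x 0F + x 1F + x 2F + x 3F < δ t
    -- The four column totals add up to `4 t + 2`, below `δ t = 4 t + 5`.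
    degree< x x≤ = s≤s (ℕ.≤-trans
      (ℕ.+-mono-≤ (ℕ.+-mono-≤ (ℕ.+-mono-≤ (x≤ 0F) (x≤ 1F)) (x≤ 2F)) (x≤ 3F))
      (ℕ.≤-trans (ℕ.m≤m+n _ 2) (ℕ.≤-reflexive (eq t))))
      where
      eq : ∀ t → t + (1 + t) + (1 + t) + t + 2 ≡ 4 + 4 * t
      eq = ℕ-Solver.solve-∀

    P≤total : ∀ k l → P {n} t k l ≤ total {n} t l
    P≤total k l = subst (P t k l ≤_) (P-total t l) (term≤sum (λ k → P t k l) k)

    -- The column sums bound the entries, so both coordinate sums are below `δ t`. They are the
    -- remainders, and the weights the quotients, of the same number divided by `δ t`.
    invariants : ∀ k → (P {n} t k 0F + P {n} t k 1F + P {n} t k 2F + P {n} t k 3F ≡ u k 0F + u k 1F + u k 2F + u k 3F) ×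
                       (weight t (P {n} t k 1F) (P {n} t k 2F) (P {n} t k 3F) ≡ weight t (u k 1F) (u k 2F) (u k 3F))
    invariants k = divMod-unique (δ t) (degree< (P t k) (P≤total k)) (degree< (u k) (u≤total k))
      (trans (sym (row₀-sum t d (P t k))) (trans (rows k) (row₀-sum t d (u k))))

    IsRow : Fin (2 + t) → (Fin (4 + n) → ℕ) → Set
    IsRow k x = Quad≡ (u k 0F) (u k 1F) (u k 2F) (u k 3F) (x 0F) (x 1F) (x 2F) (x 3F)

    middle : Fin t → Fin (2 + t)
    middle j = Fin.suc (Fin.suc j)

    dichotomy : ∀ k → IsRow k (P t k) ⊎ IsRow k (Q t k)
    dichotomy 0F = end-row t (u 0F 0F) (u 0F 1F) (u 0F 2F) (u 0F 3F)
      (trans (sym (proj₁ (invariants 0F))) (eq₁ t)) (trans (sym (proj₂ (invariants 0F))) (eq₂ t))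
      where
      eq₁ : ∀ t → 0 + (1 + t) + 0 + 0 ≡ 1 + t
      eq₁ = ℕ-Solver.solve-∀
      eq₂ : ∀ t → (1 + t) + 0 * (1 + t) + 0 * (2 + t) ≡ 1 + t
      eq₂ = ℕ-Solver.solve-∀
    -- Reversing the coordinates turns the weight w of a vector of sum s into (2 + t) s − w.
    dichotomy 1F = reverse (end-row t (u 1F 3F) (u 1F 2F) (u 1F 1F) (u 1F 0F)
        (trans (flip-sum (u 1F 0F) (u 1F 1F) (u 1F 2F) (u 1F 3F)) sum≡)
        (ℕ.+-cancelʳ-≡ (weight t (u 1F 1F) (u 1F 2F) (u 1F 3F)) _ (1 + t)
          (trans (flip-weight t (u 1F 0F) (u 1F 1F) (u 1F 2F) (u 1F 3F))
            (trans (cong (_* (2 + t)) sum≡) (trans (eq₃ t) (cong (_+_ (1 + t)) (proj₂ (invariants 1F))))))))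
      where
      flip-sum : ∀ a b c d → d + c + b + a ≡ a + b + c + d
      flip-sum = ℕ-Solver.solve-∀
      eq₁ : ∀ t → 0 + 0 + (1 + t) + 0 ≡ 1 + t
      eq₁ = ℕ-Solver.solve-∀
      sum≡ = trans (sym (proj₁ (invariants 1F))) (eq₁ t)
      flip-weight : ∀ t a b c d → (c + b * (1 + t) + a * (2 + t)) + (b + c * (1 + t) + d * (2 + t)) ≡ (a + b + c + d) * (2 + t)
      flip-weight = ℕ-Solver.solve-∀
      eq₃ : ∀ t → (1 + t) * (2 + t) ≡ (1 + t) + (0 + (1 + t) * (1 + t) + 0 * (2 + t))
      eq₃ = ℕ-Solver.solve-∀
      reverse : ∀ {a b c d} → Quad≡ d c b a 0 (1 + t) 0 0 ⊎ Quad≡ d c b a t 0 1 0 →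
                Quad≡ a b c d 0 0 (1 + t) 0 ⊎ Quad≡ a b c d 0 1 0 t
      reverse (inj₁ (p , q , r , s)) = inj₁ (s , r , q , p)
      reverse (inj₂ (p , q , r , s)) = inj₂ (s , r , q , p)
    dichotomy (Fin.suc (Fin.suc j)) = middle-row t (u K 0F) (u K 1F) (u K 2F) (u K 3F) 0<t
      (sym (proj₁ (invariants K))) (trans (sym (proj₂ (invariants K))) (ℕ.+-identityʳ (2 + t)))
      where
      K : Fin (2 + t)
      K = middle j

    bit₀ : ∀ j → u (middle j) 0F ≤ 1
    bit₀ j = [ (λ (x₀≡1 , _) → ℕ.≤-reflexive x₀≡1)
             , (λ (x₀≡0 , _) → ℕ.≤-trans (ℕ.≤-reflexive x₀≡0) z≤n) ]′ (dichotomy (middle j))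

    bit₃ : ∀ j → u (middle j) 3F ≤ 1
    bit₃ j = [ (λ (_ , _ , _ , x₃≡1) → ℕ.≤-reflexive x₃≡1)
             , (λ (_ , _ , _ , x₃≡0) → ℕ.≤-trans (ℕ.≤-reflexive x₃≡0) z≤n) ]′ (dichotomy (middle j))

    0≢1 : 0 ≢ 1
    0≢1 ()

    -- The `t` middle entries, each at most 1, have to supply the whole column sum `t`.
    middle-one : ∀ l → total {n} t l ≡ t → (∀ j → u (middle j) l ≤ 1) →
                 u 0F l ≡ 0 → u 1F l ≡ 0 → ∀ j → u (middle j) l ≡ 1
    middle-one l total≡t bits u₀≡0 u₁≡0 = all-one (λ j → u (middle j) l) bits Σ≡t
      where
      Σ≡t : sum (λ j → u (middle j) l) ≡ t
      Σ≡t = trans (sym (cong₂ (λ a b → a + (b + sum (λ j → u (middle j) l))) u₀≡0 u₁≡0)) (trans (column l) total≡t)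

    middle-zero : ∀ l → total {n} t l ≡ t → u 0F l + u 1F l ≡ t → ∀ j → u (middle j) l ≡ 0
    middle-zero l total≡t ends≡t = all-zero (λ j → u (middle j) l) Σ≡0
      where
      open ≡-Reasoning
      Σ≡0 : sum (λ j → u (middle j) l) ≡ 0
      Σ≡0 = ℕ.+-cancelˡ-≡ t (sum (λ j → u (middle j) l)) 0 (begin
        t + sum (λ j → u (middle j) l)                        ≡⟨ cong (_+ sum (λ j → u (middle j) l)) ends≡t ⟨
        u 0F l + u 1F l + sum (λ j → u (middle j) l)          ≡⟨ ℕ.+-assoc (u 0F l) (u 1F l) (sum (λ j → u (middle j) l)) ⟩
        u 0F l + (u 1F l + sum (λ j → u (middle j) l))        ≡⟨ column l ⟩
        total t l                                             ≡⟨ total≡t ⟩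
        t                                                     ≡⟨ ℕ.+-identityʳ t ⟨
        t + 0                                                 ∎)

    is-P : ∀ j → u (middle j) 0F ≡ 1 ⊎ u (middle j) 3F ≡ 1 → IsRow (middle j) (P t (middle j))
    is-P j one = [ (λ isP → isP)
                 , (λ (x₀≡0 , _ , _ , x₃≡0) → ⊥-elim ([ 0≢1 ∘ trans (sym x₀≡0) , 0≢1 ∘ trans (sym x₃≡0) ]′ one)) ]′
                 (dichotomy (middle j))

    is-Q : ∀ j → u (middle j) 0F ≡ 0 → IsRow (middle j) (Q t (middle j))
    is-Q j x₀≡0 = [ (λ (x₀≡1 , _) → ⊥-elim (0≢1 (trans (sym x₀≡0) x₀≡1))) , (λ isQ → isQ) ]′ (dichotomy (middle j))

    column-zero : ∀ k (l : Fin n) → u k (4 ↑ʳ l) ≡ 0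
    column-zero k l = ℕ.n≤0⇒n≡0 (u≤total k (4 ↑ʳ l))

    extend : ∀ {k x} → (∀ l → x (4 ↑ʳ l) ≡ 0) → IsRow k x → u k ≗ x
    extend x-tail (x₀ , x₁ , x₂ , x₃) 0F = x₀
    extend x-tail (x₀ , x₁ , x₂ , x₃) 1F = x₁
    extend x-tail (x₀ , x₁ , x₂ , x₃) 2F = x₂
    extend x-tail (x₀ , x₁ , x₂ , x₃) 3F = x₃
    extend {k} x-tail _ (Fin.suc (Fin.suc (Fin.suc (Fin.suc l)))) = trans (column-zero k l) (sym (x-tail l))

    AllP AllQ : Set
    AllP = ∀ k → u k ≗ P t k
    AllQ = ∀ k → u k ≗ Q t k

    -- The end rows decide, through columns 0 and 3 respectively, which points the middle rows take.
    assemble : IsRow 0F (P t 0F) ⊎ IsRow 0F (Q t 0F) → IsRow 1F (P t 1F) ⊎ IsRow 1F (Q t 1F) → AllP ⊎ AllQ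
    assemble (inj₁ p₀) (inj₁ p₁) = inj₁ λ
      { 0F → extend {0F} (P-tail t 0F) p₀
      ; 1F → extend {1F} (P-tail t 1F) p₁
      ; (Fin.suc (Fin.suc j)) → extend {middle j} (P-tail t (middle j))
          (is-P j (inj₁ (middle-one 0F refl bit₀ (proj₁ p₀) (proj₁ p₁) j))) }
    assemble (inj₂ q₀) (inj₂ q₁) = inj₂ λ
      { 0F → extend {0F} (Q-tail t 0F) q₀
      ; 1F → extend {1F} (Q-tail t 1F) q₁
      ; (Fin.suc (Fin.suc j)) → extend {middle j} (Q-tail t (middle j))
          (is-Q j (middle-zero 0F refl (trans (cong₂ _+_ (proj₁ q₀) (proj₁ q₁)) (ℕ.+-identityʳ t)) j)) }
    -- In a mixed choice one of the columns 0 and 3 is used up by the end rows while the other asks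
    -- for ones in the middle. These clash on any middle row, and `0 < t` provides one.
    assemble (inj₁ (p₀₀ , _ , _ , p₀₃)) (inj₂ (q₁₀ , _ , _ , q₁₃)) = ⊥-elim (0≢1
        (trans (sym (middle-zero 3F refl (cong₂ _+_ p₀₃ q₁₃) j))
               (proj₂ (proj₂ (proj₂ (is-P j (inj₁ (middle-one 0F refl bit₀ p₀₀ q₁₀ j))))))))
      where j = fromℕ< 0<t
    assemble (inj₂ (q₀₀ , _ , _ , q₀₃)) (inj₁ (p₁₀ , _ , _ , p₁₃)) = ⊥-elim (0≢1
        (trans (sym (middle-zero 0F refl (trans (cong₂ _+_ q₀₀ p₁₀) (ℕ.+-identityʳ t)) j))
               (proj₁ (is-P j (inj₂ (middle-one 3F refl bit₃ q₀₃ p₁₃ j))))))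
      where j = fromℕ< 0<t

  fiber : (∀ k → u k ≗ P t k) ⊎ (∀ k → u k ≗ Q t k)
  fiber = assemble (dichotomy 0F) (dichotomy 1F)

-- Arrays as vectors of the lifting, and the type of the indispensable element

flatten : (Fin r → Fin n → ℕ) → Fin (r ℕ.* n) → ℕ
flatten {r} {n} X i = X (proj₁ (remQuot {r} n i)) (proj₂ (remQuot {r} n i))

flatten-combine : (X : Fin r → Fin n → ℕ) → ∀ k l → flatten X (combine k l) ≡ X k l
flatten-combine X k l = cong (λ kl → X (proj₁ kl) (proj₂ kl)) (Fin.remQuot-combine k l)

≗-flatten : (u : Fin (r ℕ.* n) → ℕ) (X : Fin r → Fin n → ℕ) → (∀ k l → u (combine k l) ≡ X k l) → u ≗ flatten X
≗-flatten {r} {n} u X u≡X i = trans (cong u (sym (Fin.combine-remQuot {r} n i))) (u≡X _ _)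

-- Column 1 is nonzero in each of `v₀`, `u` and `v₀ + t u`, so it witnesses at once that every row
-- counts towards the type.
P≢Q : ∀ t k → + P {n} t k 1F ℤ.- + Q {n} t k 1F ≢ + 0
P≢Q t 0F                    ()
P≢Q t 1F                    ()
P≢Q t (Fin.suc (Fin.suc _)) ()

theorem6p1 : (n d m : ℕ) → 4 ≤ n → 1 ≤ d → d + 2 ≤ n → d ≤ m →
    (N : ℕ) → 1 ≤ N →
    Σ (Matrix m n) λ A → HasRank A d × MarkovComplexityAtLeast A N
theorem6p1 (suc (suc (suc (suc n)))) (suc d) (suc m) 4≤n@(s≤s (s≤s (s≤s (s≤s _)))) _ d+2≤n d≤m N 1≤N =
  A , example-rank N 4≤n d+2≤n d≤m , R , s≤s (s≤s z≤n) , diff P♭ Q♭ ,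
  indispensable⇒universal L (lawrence-graded A R) P♭ Q♭ P♭≢Q♭ P♭-Q♭∈ker fiber-of-P♭ ,
  subst (N ≤_) (sym (typeOf-full {4 + n} R (diff P♭ Q♭) 1F differ)) (ℕ.m≤n+m N 2)
  where
  e : Fin (suc m) → Fin (4 + n) → ℕ
  e a l = cell N (suc d) (toℕ a) (toℕ l)
  A = example N (suc d) (suc m) (4 + n)
  -- One row for `v₀`, one for `−(v₀ + N u)` and `N` rows for the copies of `u`.
  R = 2 + N
  L = lawrence A R
  P♭ Q♭ : Fin (R ℕ.* (4 + n)) → ℕ
  P♭ = flatten (P N)
  Q♭ = flatten (Q N)
  P♭≡ : ∀ k l → P♭ (combine k l) ≡ P N k l
  P♭≡ = flatten-combine (P N)
  Q♭≡ : ∀ k l → Q♭ (combine k l) ≡ Q N k l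
  Q♭≡ = flatten-combine (Q N)

  differ : ∀ k → diff P♭ Q♭ (combine {R} {4 + n} k 1F) ≢ + 0
  differ k eq = P≢Q {n} N k (trans (sym (cong₂ (λ a b → + a ℤ.- + b) (P♭≡ k 1F) (Q♭≡ k 1F))) eq)

  P♭≢Q♭ : ¬ P♭ ≗ Q♭
  P♭≢Q♭ P♭≗Q♭ = differ 0F (ℤ.i≡j⇒i-j≡0 (cong +_ (P♭≗Q♭ (combine {R} {4 + n} 0F 1F))))

  P♭-Q♭∈ker : InKer L (diff P♭ Q♭)
  P♭-Q♭∈ker = lawrence-fiber⁺ e R P♭ Q♭
    (λ k a → trans (sum-cong-≗ (λ l → cong (e a l *_) (P♭≡ k l)))
      (trans (P-Q-balanced N (suc d) (toℕ a) k) (sum-cong-≗ (λ l → cong (e a l *_) (sym (Q♭≡ k l))))))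
    (λ l → trans (sum-cong-≗ (λ k → P♭≡ k l))
      (trans (trans (P-total N l) (sym (Q-total N l))) (sum-cong-≗ (λ k → sym (Q♭≡ k l)))))

  -- Row 0 of `A` and the column sums already pin down the fiber, which covers every rank from 1 on.
  fiber-of-P♭ : ∀ u → InKer L (diff P♭ u) → u ≗ P♭ ⊎ u ≗ Q♭
  fiber-of-P♭ u P♭-u∈ = ⊎.map (≗-flatten u (P N)) (≗-flatten u (Q N)) (fiber 1≤N (λ k l → u (combine k l)) d
    (λ k → trans (sum-cong-≗ (λ l → cong (e 0F l *_) (sym (P♭≡ k l)))) (lawrence-fiber⁻-row e R P♭ u P♭-u∈ k 0F))
    (λ l → trans (sum-cong-≗ (λ k → sym (P♭≡ k l))) (lawrence-fiber⁻-col e R P♭ u P♭-u∈ l)))
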